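{- Let $L$ be a finite set of $n$ great circles on the sphere $S^2$ in general position (no three of them pass through a common point). Then there exists a vertex $v$ of the arrangement $\mathcal{A}(L)$ such that $C(v)\le 5$; that is, $C(L)\le 5$.
   Context: $\mathcal{A}(L)$ denotes the arrangement of vertices, edges and faces on the sphere determined by $L$; a vertex is an intersection point of two great circles of $L$ (each pair meets in two antipodal vertices). The size of a face is the number of edges (equivalently, vertices) on its boundary. For a vertex $v$, let $\ell^v_1,\ell^v_2$ be the two great circles of $L$ passing through $v$; the zone complexity $C(v)$ is the size of the face of the arrangement $\mathcal{A}(L\setminus\{\ell^v_1,\ell^v_2\})$ that contains the point $v$. $C(L)$ denotes the minimum of $C(v)$ over all vertices $v$ of $\mathcal{A}(L)$. -}

module Defs where

open import Level using (Level; _⊔_) renaming (suc to lsuc)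
open import Algebra.Bundles using (CommutativeRing)
open import Relation.Binary.Core using (Rel)
open import Relation.Binary.Structures using (IsStrictTotalOrder)
open import Relation.Binary.Definitions using (tri<; tri≈; tri>)
open import Relation.Nullary using (¬_; does)
open import Data.Bool using (Bool; true; false; not; _∧_; _∨_; if_then_else_)
open import Data.Nat using (ℕ; _<ᵇ_)
open import Data.Fin using (Fin; toℕ; _≟_)
open import Data.Product using (_×_; _,_)
open import Data.List using (List; _∷_; []; allFin; concatMap; map; filterᵇ; length)
open import Data.Bool.ListAction using (all)
open import Relation.Binary.PropositionalEquality using (_≢_)

-- An ordered commutative ring: a commutative ring with a strict total order
-- compatible with addition and multiplication (ℝ is the intended model;
-- great circles are given by their normal vectors in R³).
record OrderedCommutativeRing (c ℓ₁ ℓ₂ : Level) : Set (lsuc (c ⊔ ℓ₁ ⊔ ℓ₂)) where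
  field
    commutativeRing : CommutativeRing c ℓ₁
  open CommutativeRing commutativeRing public
  field
    _<_                : Rel Carrier ℓ₂
    isStrictTotalOrder : IsStrictTotalOrder _≈_ _<_
    +-monoˡ-<          : ∀ z {x y} → x < y → (x + z) < (y + z)
    *-pos              : ∀ {x y} → 0# < x → 0# < y → 0# < (x * y)
  open IsStrictTotalOrder isStrictTotalOrder public using (compare)

data Sign : Set where
  neg zer pos : Sign

strictlyOpposite : Sign → Sign → Bool
strictlyOpposite pos neg = true
strictlyOpposite neg pos = true
strictlyOpposite _   _   = false

module Sphere {c ℓ₁ ℓ₂} (R : OrderedCommutativeRing c ℓ₁ ℓ₂) where
  open OrderedCommutativeRing R

  Vec3 : Set c
  Vec3 = Carrier × Carrier × Carrier

  cross : Vec3 → Vec3 → Vec3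
  cross (a₁ , a₂ , a₃) (b₁ , b₂ , b₃) =
    (a₂ * b₃ - a₃ * b₂) , (a₃ * b₁ - a₁ * b₃) , (a₁ * b₂ - a₂ * b₁)

  dot : Vec3 → Vec3 → Carrier
  dot (a₁ , a₂ , a₃) (b₁ , b₂ , b₃) = a₁ * b₁ + a₂ * b₂ + a₃ * b₃

  negV : Vec3 → Vec3
  negV (a₁ , a₂ , a₃) = (- a₁) , (- a₂) , (- a₃)

  det : Vec3 → Vec3 → Vec3 → Carrier
  det a b d = dot a (cross b d)

  IsZeroVec : Vec3 → Set ℓ₁
  IsZeroVec (a₁ , a₂ , a₃) = (a₁ ≈ 0#) × (a₂ ≈ 0#) × (a₃ ≈ 0#)

  sign : Carrier → Sign
  sign x with compare x 0#
  ... | tri< _ _ _ = neg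
  ... | tri≈ _ _ _ = zer
  ... | tri> _ _ _ = pos

  -- A finite family of n great circles, circle i being {x ∈ S² | dot (L i) x = 0}.
  -- General position: distinct circles (normals pairwise non-parallel) and
  -- no three circles through a common point (any three normals independent).
  GeneralPosition : ∀ {n} → (Fin n → Vec3) → Set ℓ₁
  GeneralPosition {n} L =
    (∀ (i j : Fin n) → i ≢ j → ¬ IsZeroVec (cross (L i) (L j))) ×
    (∀ (i j k : Fin n) → i ≢ j → j ≢ k → i ≢ k → ¬ (det (L i) (L j) (L k) ≈ 0#))

  -- The vertex of A(L) on circles i and j: the point ±(L i × L j) (direction
  -- on the sphere), sign chosen by the Boolean s.
  vertexPoint : ∀ {n} → (Fin n → Vec3) → Fin n → Fin n → Bool → Vec3
  vertexPoint L i j true  = cross (L i) (L j)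
  vertexPoint L i j false = negV (cross (L i) (L j))

  notIn : ∀ {n} → Fin n → Fin n → Fin n → Bool
  notIn i j m = not (does (m ≟ i)) ∧ not (does (m ≟ j))

  -- w lies in the closure of the face of A(L \ {ℓ_i, ℓ_j}) containing v:
  -- w is not strictly on the other side of any remaining circle.
  inFaceClosure : ∀ {n} → (Fin n → Vec3) → Fin n → Fin n → Vec3 → Vec3 → Bool
  inFaceClosure {n} L i j v w =
    all (λ m → not (notIn i j m) ∨
                 not (strictlyOpposite (sign (dot (L m) v)) (sign (dot (L m) w))))
        (allFin n)

  subVertices : ∀ {n} → Fin n → Fin n → List (Fin n × Fin n × Bool)
  subVertices {n} i j =
    filterᵇ (λ { (k , l , _) → (toℕ k <ᵇ toℕ l) ∧ notIn i j k ∧ notIn i j l })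
      (concatMap (λ k → concatMap (λ l → (k , l , true) ∷ (k , l , false) ∷ [])
                                  (allFin n)) (allFin n))

  -- C(v) for v = vertexPoint L i j s: the size of the face of
  -- A(L \ {ℓ_i, ℓ_j}) containing v, counted as the number of vertices of
  -- A(L \ {ℓ_i, ℓ_j}) on its boundary.
  zoneComplexity : ∀ {n} → (Fin n → Vec3) → Fin n → Fin n → Bool → ℕ
  zoneComplexity L i j s =
    length (filterᵇ (λ { (k , l , t) →
                           inFaceClosure L i j (vertexPoint L i j s) (vertexPoint L k l t) })
                    (subVertices i j))

{-# OPTIONS --safe #-}

-- Discharging.  Write |f| for the size of a face f.  Deleting the two circles
-- through v merges the four faces at v, so C(v) is (for n ≥ 5) the sum of their
-- sizes minus 12; suppose this is at least 6 everywhere.  Orienting all circles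
-- around a point N selects one corner at each vertex, at most one corner in each
-- face and none in the face of N; hence the sum of |f| - 4 over all faces is
-- negative.  On the other hand every face f with |f| ≥ 4 can spread at most its
-- charge |f| - 4 over its corners so that each triangle collects at least 1:
-- charges are spread evenly, except that a heptagon moves a little towards corners
-- which face a triangle between two quadrilaterals.  This works because triangles
-- are neither adjacent to each other nor adjacent to opposite sides of a
-- quadrilateral: two circles would otherwise cross at both ends of a lune met by
-- at most two further circles.
module Submission where

-- Heptagons are singled out because of one tight configuration: a triangle with neighbours of sizes
-- 4, 4 and 8, a heptagon opposite at the vertex between the quadrilaterals, and triangles opposite
-- at the other two vertices. There the octagon's share of 210, in units of 1/420, is halved each
-- time, so 210 are left for the heptagon to give, while its even share is 180. The missing 30 are
-- taken from the preceding corner of the heptagon. That corner is not itself in need of 210, since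
-- two such corners in succession would put triangles on opposite sides of a quadrilateral.
--
-- No graph on the sphere is built. A face is a sign vector and a corner of it a condition on signs
-- of determinants; sums run over all 2^n sign vectors, and those of no face have no corners and
-- contribute nothing. The four faces at a vertex differ in two signs only, so double counting
-- becomes invariance of sums under flips. The count of selected corners takes the place of Euler's
-- formula.

open import Defs
open import Level using (0ℓ)
open import Algebra.Bundles using (CommutativeRing; RawRing)
open import Algebra.Solver.Ring.AlmostCommutativeRing
  using (fromCommutativeRing; _-Raw-AlmostCommutative⟶_)
import Algebra.Properties.AbelianGroup as AbelianGroupProperties
import Algebra.Properties.Ring as RingProperties
import Algebra.Properties.Semiring.Mult as Mult
import Algebra.Solver.Ring as Solver
open import Data.Bool using (Bool; true; false; not; if_then_else_; _∧_; _∨_; _xor_; T)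
open import Data.Bool.ListAction using (all)
import Data.Bool.Properties as 𝔹
open import Data.Empty using (⊥; ⊥-elim)
open import Data.Fin as Fin using (Fin; _≟_; toℕ)
open import Data.Fin.Properties using (any?; all?)
import Data.Fin.Properties as Finₚ
open import Data.List as List using (List; []; _∷_; _++_; length; allFin; tabulate; concatMap; filterᵇ; foldr)
open import Data.List.Membership.Propositional using (_∈_; _∉_)
open import Data.List.Membership.Propositional.Properties using (∈-allFin)
open import Data.List.Relation.Unary.All as All using (All; []; _∷_)
open import Data.List.Relation.Unary.AllPairs using ([]; _∷_)
open import Data.List.Relation.Unary.Any using (here; there; index)
open import Data.List.Relation.Unary.Unique.Propositional using (Unique)
open import Data.Maybe using (Maybe; just; nothing)
open import Data.Nat as ℕ using (ℕ; suc; _≤_; z≤n; s≤s)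
import Data.Nat.ListAction as Listₙ
import Data.Nat.Properties as ℕₚ
open import Data.Nat.Solver using (module +-*-Solver)
open import Data.Product using (∃; _×_; _,_; proj₁; proj₂)
open import Data.Sum using (_⊎_; inj₁; inj₂)
open import Data.Vec as Vec using (Vec; []; _∷_; updateAt; lookup)
import Data.Vec.Properties as Vecₚ
open import Function using (_∘_; case_of_)
open import Relation.Binary.Definitions using (tri<; tri≈; tri>)
open import Relation.Binary.PropositionalEquality as ≡ using (_≡_; _≢_; cong; cong₂; subst)
import Relation.Binary.Reasoning.Setoid as SetoidReasoning
open import Relation.Binary.Structures using (IsStrictTotalOrder)
open import Relation.Nullary using (¬_; Dec; yes; no; does; contradiction; ¬?; _×-dec_; _⊎-dec_; _→-dec_)
open import Relation.Nullary.Decidable using (dec-true; dec-false; from-yes; map′)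

-- Polynomial identities over a commutative ring

-- Integer coefficients as formal differences of naturals; cancellation in the
-- solver needs coefficients with decidable equality.
module DifferenceSolver {c ℓ} (R : CommutativeRing c ℓ) where
  open CommutativeRing R
  open RingProperties ring
  open AbelianGroupProperties +-abelianGroup using (⁻¹-∙-comm)
  open Mult semiring using (×-homo-+; ×1-homo-*) renaming (_×_ to _×ₙ_)
  open SetoidReasoning setoid

  Difference : RawRing 0ℓ 0ℓ
  Difference = record
    { Carrier = ℕ × ℕ
    ; _≈_ = _≡_
    ; _+_ = λ (a , b) (c , d) → a ℕ.+ c , b ℕ.+ d
    ; _*_ = λ (a , b) (c , d) → a ℕ.* c ℕ.+ b ℕ.* d , a ℕ.* d ℕ.+ b ℕ.* c
    ; -_ = λ (a , b) → b , a
    ; 0# = 0 , 0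
    ; 1# = 1 , 0
    }

  ⟪_⟫ : ℕ → Carrier
  ⟪ n ⟫ = n ×ₙ 1#

  ⟪⟫-+ : ∀ m n → ⟪ m ℕ.+ n ⟫ ≈ ⟪ m ⟫ + ⟪ n ⟫
  ⟪⟫-+ = ×-homo-+ 1#

  ⟪⟫-* : ∀ m n → ⟪ m ℕ.* n ⟫ ≈ ⟪ m ⟫ * ⟪ n ⟫
  ⟪⟫-* = ×1-homo-*

  interchange : ∀ a b c d → (a + b) + (c + d) ≈ (a + c) + (b + d)
  interchange a b c d = begin
    (a + b) + (c + d) ≈⟨ +-assoc a b (c + d) ⟩
    a + (b + (c + d)) ≈⟨ +-congˡ (+-assoc b c d) ⟨
    a + ((b + c) + d) ≈⟨ +-congˡ (+-congʳ (+-comm b c)) ⟩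
    a + ((c + b) + d) ≈⟨ +-congˡ (+-assoc c b d) ⟩
    a + (c + (b + d)) ≈⟨ +-assoc a c (b + d) ⟨
    (a + c) + (b + d) ∎

  difference-+ : ∀ a b c d → (a + c) - (b + d) ≈ (a - b) + (c - d)
  difference-+ a b c d = begin
    (a + c) - (b + d)       ≈⟨ +-congˡ (⁻¹-∙-comm b d) ⟨
    (a + c) + (- b + - d)   ≈⟨ interchange a c (- b) (- d) ⟩
    (a - b) + (c - d)       ∎

  difference-* : ∀ a b c d → (a * c + b * d) - (a * d + b * c) ≈ (a - b) * (c - d)
  difference-* a b c d = begin
    (a * c + b * d) - (a * d + b * c)         ≈⟨ difference-+ _ _ _ _ ⟩
    (a * c - a * d) + (b * d - b * c)         ≈⟨ +-cong (+-congˡ (-‿distribʳ-* a d)) (+-congʳ (sym (-‿involutive (b * d)))) ⟩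
    (a * c + a * - d) + (- - (b * d) - b * c) ≈⟨ +-cong (sym (distribˡ a c (- d))) (+-comm _ _) ⟩
    a * (c - d) + (- (b * c) - - (b * d))     ≈⟨ +-congˡ (⁻¹-∙-comm _ _) ⟩
    a * (c - d) - (b * c - b * d)             ≈⟨ +-congˡ (-‿cong (+-congˡ (-‿distribʳ-* b d))) ⟩
    a * (c - d) - (b * c + b * - d)           ≈⟨ +-congˡ (-‿cong (distribˡ b c (- d))) ⟨
    a * (c - d) - b * (c - d)                 ≈⟨ +-congˡ (-‿distribˡ-* b (c - d)) ⟩
    a * (c - d) + - b * (c - d)               ≈⟨ distribʳ (c - d) a (- b) ⟨
    (a - b) * (c - d)                         ∎

  difference-cong : ∀ a b c d → a + d ≈ c + b → a - b ≈ c - d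
  difference-cong a b c d eq = begin
    a - b                 ≈⟨ +-identityʳ _ ⟨
    (a - b) + 0#          ≈⟨ +-congˡ (-‿inverseʳ d) ⟨
    (a - b) + (d - d)     ≈⟨ difference-+ a b d d ⟨
    (a + d) - (b + d)     ≈⟨ +-cong eq (-‿cong (+-comm b d)) ⟩
    (c + b) - (d + b)     ≈⟨ difference-+ c d b b ⟩
    (c - d) + (b - b)     ≈⟨ +-congˡ (-‿inverseʳ b) ⟩
    (c - d) + 0#          ≈⟨ +-identityʳ _ ⟩
    c - d                 ∎

  evaluation : Difference -Raw-AlmostCommutative⟶ fromCommutativeRing R
  evaluation = record
    { ⟦_⟧ = λ (a , b) → ⟪ a ⟫ - ⟪ b ⟫
    ; +-homo = λ (a , b) (c , d) → trans
        (+-cong (⟪⟫-+ a c) (-‿cong (⟪⟫-+ b d)))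
        (difference-+ ⟪ a ⟫ ⟪ b ⟫ ⟪ c ⟫ ⟪ d ⟫)
    ; *-homo = λ (a , b) (c , d) → trans
        (+-cong (sum-of-products a c b d) (-‿cong (sum-of-products a d b c)))
        (difference-* ⟪ a ⟫ ⟪ b ⟫ ⟪ c ⟫ ⟪ d ⟫)
    ; -‿homo = λ (a , b) → begin
        ⟪ b ⟫ - ⟪ a ⟫       ≈⟨ +-congʳ (-‿involutive ⟪ b ⟫) ⟨
        - - ⟪ b ⟫ - ⟪ a ⟫   ≈⟨ +-comm _ _ ⟩
        - ⟪ a ⟫ - - ⟪ b ⟫   ≈⟨ ⁻¹-∙-comm _ _ ⟩
        - (⟪ a ⟫ - ⟪ b ⟫)   ∎
    ; 0-homo = -‿inverseʳ 0#
    ; 1-homo = begin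
        ⟪ 1 ⟫ - 0#   ≈⟨ +-congˡ -0#≈0# ⟩
        ⟪ 1 ⟫ + 0#   ≈⟨ +-identityʳ _ ⟩
        1# + 0#      ≈⟨ +-identityʳ _ ⟩
        1#           ∎
    }
    where
    sum-of-products : ∀ a b c d → ⟪ a ℕ.* b ℕ.+ c ℕ.* d ⟫ ≈ ⟪ a ⟫ * ⟪ b ⟫ + ⟪ c ⟫ * ⟪ d ⟫
    sum-of-products a b c d =
      trans (⟪⟫-+ (a ℕ.* b) (c ℕ.* d)) (+-cong (⟪⟫-* a b) (⟪⟫-* c d))

  _coeff≟_ : (x y : ℕ × ℕ) → Maybe (⟪ proj₁ x ⟫ - ⟪ proj₂ x ⟫ ≈ ⟪ proj₁ y ⟫ - ⟪ proj₂ y ⟫)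
  (a , b) coeff≟ (c , d) with a ℕ.+ d ℕ.≟ c ℕ.+ b
  ... | no _ = nothing
  ... | yes eq = just (difference-cong ⟪ a ⟫ ⟪ b ⟫ ⟪ c ⟫ ⟪ d ⟫
          (trans (sym (⟪⟫-+ a d)) (trans (reflexive (≡.cong ⟪_⟫ eq)) (⟪⟫-+ c b))))

  open Solver Difference (fromCommutativeRing R) evaluation _coeff≟_ public

-- Positivity in ordered rings

module OrderedRing {c ℓ₁ ℓ₂} (R : OrderedCommutativeRing c ℓ₁ ℓ₂) where
  open OrderedCommutativeRing R public renaming (_<_ to infix 4 _<_)
  open IsStrictTotalOrder isStrictTotalOrder public
    using (_<?_; irrefl; asym; <-respʳ-≈; <-respˡ-≈) renaming (trans to <-trans)
  open RingProperties ring public using (-0#≈0#; -‿involutive; -‿distribˡ-*; -‿distribʳ-*)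

  Nonnegative : Carrier → Set _
  Nonnegative x = 0# < x ⊎ x ≈ 0#

  +-positive : ∀ {x y} → 0# < x → 0# < y → 0# < x + y
  +-positive {x} {y} 0<x 0<y = <-trans 0<y (<-respˡ-≈ (+-identityˡ y) (+-monoˡ-< y 0<x))

  +-positive-nonnegative : ∀ {x y} → 0# < x → Nonnegative y → 0# < x + y
  +-positive-nonnegative 0<x (inj₁ 0<y) = +-positive 0<x 0<y
  +-positive-nonnegative {x} 0<x (inj₂ y≈0) = <-respʳ-≈ (sym (trans (+-congˡ y≈0) (+-identityʳ x))) 0<x

  +-nonnegative-positive : ∀ {x y} → Nonnegative x → 0# < y → 0# < x + y
  +-nonnegative-positive {x} {y} 0≤x 0<y = <-respʳ-≈ (+-comm y x) (+-positive-nonnegative 0<y 0≤x)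

  +-nonnegative : ∀ {x y} → Nonnegative x → Nonnegative y → Nonnegative (x + y)
  +-nonnegative (inj₁ 0<x) 0≤y = inj₁ (+-positive-nonnegative 0<x 0≤y)
  +-nonnegative 0≤x (inj₁ 0<y) = inj₁ (+-nonnegative-positive 0≤x 0<y)
  +-nonnegative (inj₂ x≈0) (inj₂ y≈0) = inj₂ (trans (+-cong x≈0 y≈0) (+-identityˡ 0#))

  *-nonnegative : ∀ {x y} → 0# < x → Nonnegative y → Nonnegative (x * y)
  *-nonnegative 0<x (inj₁ 0<y) = inj₁ (*-pos 0<x 0<y)
  *-nonnegative {x} _ (inj₂ y≈0) = inj₂ (trans (*-congˡ y≈0) (zeroʳ x))

  nonnegative-resp-≈ : ∀ {x y} → x ≈ y → Nonnegative x → Nonnegative y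
  nonnegative-resp-≈ x≈y (inj₁ 0<x) = inj₁ (<-respʳ-≈ x≈y 0<x)
  nonnegative-resp-≈ x≈y (inj₂ x≈0) = inj₂ (trans (sym x≈y) x≈0)

  negative⇒-positive : ∀ {x} → x < 0# → 0# < - x
  negative⇒-positive {x} x<0 = <-respˡ-≈ (-‿inverseʳ x) (<-respʳ-≈ (+-identityˡ (- x)) (+-monoˡ-< (- x) x<0))

  positive⇒-negative : ∀ {x} → 0# < x → - x < 0#
  positive⇒-negative {x} 0<x = <-respʳ-≈ (-‿inverseʳ x) (<-respˡ-≈ (+-identityˡ (- x)) (+-monoˡ-< (- x) 0<x))

  positive⇒¬nonnegative : ∀ {x y} → 0# < x → y ≈ - x → ¬ Nonnegative y
  positive⇒¬nonnegative 0<x y≈-x (inj₁ 0<y) = asym 0<y (<-respˡ-≈ (sym y≈-x) (positive⇒-negative 0<x))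
  positive⇒¬nonnegative 0<x y≈-x (inj₂ y≈0) = irrefl (trans (sym y≈-x) y≈0) (positive⇒-negative 0<x)

  -- The ring need not have division, so a positive factor is removed by trichotomy for the other
  -- one.
  *-cancel-positive : ∀ {x y} → 0# < y → 0# < x * y → 0# < x
  *-cancel-positive {x} {y} 0<y 0<xy with compare x 0#
  ... | tri> _ _ 0<x = 0<x
  ... | tri≈ _ x≈0 _ = ⊥-elim (irrefl (sym (trans (*-congʳ x≈0) (zeroˡ y))) 0<xy)
  ... | tri< x<0 _ _ = ⊥-elim (asym 0<xy (<-respˡ-≈ (-‿involutive (x * y))
      (positive⇒-negative (<-respʳ-≈ (sym (-‿distribˡ-* x y)) (*-pos (negative⇒-positive x<0) 0<y)))))

  positive? : Carrier → Bool
  positive? x = does (0# <? x)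

  positive?-true : ∀ {x} → 0# < x → positive? x ≡ true
  positive?-true {x} 0<x = dec-true (0# <? x) 0<x

  positive?⁻¹ : ∀ {x} → positive? x ≡ true → 0# < x
  positive?⁻¹ {x} eq with 0# <? x
  ... | yes 0<x = 0<x
  positive?⁻¹ {x} () | no _

  positive?-cong : ∀ {x y} → x ≈ y → positive? x ≡ positive? y
  positive?-cong {x} {y} x≈y with 0# <? x
  ... | yes 0<x = ≡.sym (dec-true (0# <? y) (<-respʳ-≈ x≈y 0<x))
  ... | no ¬0<x = ≡.sym (dec-false (0# <? y) (¬0<x ∘ <-respʳ-≈ (sym x≈y)))

  positive?-neg : ∀ {x y} → ¬ (x ≈ 0#) → y ≈ - x → positive? y ≡ not (positive? x)
  positive?-neg {x} {y} x≉0 y≈-x with compare x 0#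
  ... | tri< x<0 _ ¬0<x rewrite dec-false (0# <? x) ¬0<x =
    dec-true (0# <? y) (<-respʳ-≈ (sym y≈-x) (negative⇒-positive x<0))
  ... | tri≈ _ x≈0 _ = ⊥-elim (x≉0 x≈0)
  ... | tri> _ _ 0<x rewrite dec-true (0# <? x) 0<x =
    dec-false (0# <? y) (λ 0<y → asym 0<y (<-respˡ-≈ (sym y≈-x) (positive⇒-negative 0<x)))

-- Identities for dot products, cross products and determinants

module Vectors {c ℓ₁ ℓ₂} (R : OrderedCommutativeRing c ℓ₁ ℓ₂) where
  open OrderedRing R
  open Sphere R
  open DifferenceSolver commutativeRing using (Polynomial; solve; _:=_; _:+_; _:-_; _:*_; :-_)

  private
    PVec : ℕ → Set
    PVec n = Polynomial n × Polynomial n × Polynomial n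

    infix 9 _:×_
    _:×_ : ∀ {n} → PVec n → PVec n → PVec n
    (a₁ , a₂ , a₃) :× (b₁ , b₂ , b₃) =
      (a₂ :* b₃ :- a₃ :* b₂) , (a₃ :* b₁ :- a₁ :* b₃) , (a₁ :* b₂ :- a₂ :* b₁)

    infix 8 _:∙_
    _:∙_ : ∀ {n} → PVec n → PVec n → Polynomial n
    (a₁ , a₂ , a₃) :∙ (b₁ , b₂ , b₃) = a₁ :* b₁ :+ a₂ :* b₂ :+ a₃ :* b₃

    :neg : ∀ {n} → PVec n → PVec n
    :neg (a₁ , a₂ , a₃) = :- a₁ , :- a₂ , :- a₃

    _:⊕_ : ∀ {n} → PVec n → PVec n → PVec n
    (a₁ , a₂ , a₃) :⊕ (b₁ , b₂ , b₃) = a₁ :+ b₁ , a₂ :+ b₂ , a₃ :+ b₃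

  _⊕_ : Vec3 → Vec3 → Vec3
  (a₁ , a₂ , a₃) ⊕ (b₁ , b₂ , b₃) = a₁ + b₁ , a₂ + b₂ , a₃ + b₃

  dot-⊕ : ∀ p u v → dot p (u ⊕ v) ≈ dot p u + dot p v
  dot-⊕ (p₁ , p₂ , p₃) (a₁ , a₂ , a₃) (b₁ , b₂ , b₃) =
    solve 9 (λ p₁ p₂ p₃ a₁ a₂ a₃ b₁ b₂ b₃ →
      let p = p₁ , p₂ , p₃ ; a = a₁ , a₂ , a₃ ; b = b₁ , b₂ , b₃ in
      p :∙ (a :⊕ b) := p :∙ a :+ p :∙ b) refl p₁ p₂ p₃ a₁ a₂ a₃ b₁ b₂ b₃

  dot-comm : ∀ p u → dot p u ≈ dot u p
  dot-comm (p₁ , p₂ , p₃) (a₁ , a₂ , a₃) =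
    solve 6 (λ p₁ p₂ p₃ a₁ a₂ a₃ → let p = p₁ , p₂ , p₃ ; a = a₁ , a₂ , a₃ in
      p :∙ a := a :∙ p) refl p₁ p₂ p₃ a₁ a₂ a₃

  dot-negˡ : ∀ p u → dot (negV p) u ≈ - dot p u
  dot-negˡ (p₁ , p₂ , p₃) (a₁ , a₂ , a₃) =
    solve 6 (λ p₁ p₂ p₃ a₁ a₂ a₃ → let p = p₁ , p₂ , p₃ ; a = a₁ , a₂ , a₃ in
      :neg p :∙ a := :- (p :∙ a)) refl p₁ p₂ p₃ a₁ a₂ a₃

  dot-negʳ : ∀ p u → dot p (negV u) ≈ - dot p u
  dot-negʳ (p₁ , p₂ , p₃) (a₁ , a₂ , a₃) =
    solve 6 (λ p₁ p₂ p₃ a₁ a₂ a₃ → let p = p₁ , p₂ , p₃ ; a = a₁ , a₂ , a₃ in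
      p :∙ :neg a := :- (p :∙ a)) refl p₁ p₂ p₃ a₁ a₂ a₃

  det-cycle : ∀ a b d → det a b d ≈ det b d a
  det-cycle (a₁ , a₂ , a₃) (b₁ , b₂ , b₃) (d₁ , d₂ , d₃) =
    solve 9 (λ a₁ a₂ a₃ b₁ b₂ b₃ d₁ d₂ d₃ →
      let a = a₁ , a₂ , a₃ ; b = b₁ , b₂ , b₃ ; d = d₁ , d₂ , d₃ in
      a :∙ (b :× d) := b :∙ (d :× a)) refl a₁ a₂ a₃ b₁ b₂ b₃ d₁ d₂ d₃

  det-swap : ∀ a b d → det b a d ≈ - det a b d
  det-swap (a₁ , a₂ , a₃) (b₁ , b₂ , b₃) (d₁ , d₂ , d₃) =
    solve 9 (λ a₁ a₂ a₃ b₁ b₂ b₃ d₁ d₂ d₃ →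
      let a = a₁ , a₂ , a₃ ; b = b₁ , b₂ , b₃ ; d = d₁ , d₂ , d₃ in
      b :∙ (a :× d) := :- (a :∙ (b :× d))) refl a₁ a₂ a₃ b₁ b₂ b₃ d₁ d₂ d₃

  det-repeat : ∀ a b → det a a b ≈ 0#
  det-repeat (a₁ , a₂ , a₃) (b₁ , b₂ , b₃) = trans
    (solve 6 (λ a₁ a₂ a₃ b₁ b₂ b₃ →
      let a = a₁ , a₂ , a₃ ; b = b₁ , b₂ , b₃ in
      -- The difference `a₁ :- a₁` is a way to write zero without a constant polynomial.
      a :∙ (a :× b) := a₁ :- a₁) refl a₁ a₂ a₃ b₁ b₂ b₃)
    (-‿inverseʳ a₁)

  det-repeat′ : ∀ a b → det b a b ≈ 0#
  det-repeat′ a b = trans (det-swap a b b) (trans (-‿cong (trans (det-cycle a b b) (det-repeat b a))) -0#≈0#)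

  -- The double cross product (x × y) × w = (x · w) y - (y · w) x, paired with `p`. The minus sign
  -- is attached to `dot p x` because `turn-expand` uses it where this negative is positive.
  cross-cross : ∀ p x y w → dot p (cross (cross x y) w) ≈ dot p y * dot x w + - dot p x * dot y w
  cross-cross (p₁ , p₂ , p₃) (a₁ , a₂ , a₃) (b₁ , b₂ , b₃) (d₁ , d₂ , d₃) =
    solve 12 (λ p₁ p₂ p₃ a₁ a₂ a₃ b₁ b₂ b₃ d₁ d₂ d₃ →
      let p = p₁ , p₂ , p₃ ; a = a₁ , a₂ , a₃ ; b = b₁ , b₂ , b₃ ; d = d₁ , d₂ , d₃ in
      p :∙ ((a :× b) :× d) := (p :∙ b) :* (a :∙ d) :+ (:- (p :∙ a)) :* (b :∙ d))
      refl p₁ p₂ p₃ a₁ a₂ a₃ b₁ b₂ b₃ d₁ d₂ d₃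

  -- Four vectors of 3-space satisfy a linear relation whose coefficients are their 3 by 3
  -- determinants; here it is paired with `p`. For `p` orthogonal to `j` the last term vanishes,
  -- which gives `transitive`.
  cramer : ∀ j a b d p →
    det j a d * dot p b ≈ det j a b * dot p d + det j b d * dot p a - det a b d * dot p j
  cramer (j₁ , j₂ , j₃) (a₁ , a₂ , a₃) (b₁ , b₂ , b₃) (d₁ , d₂ , d₃) (p₁ , p₂ , p₃) =
    solve 15 (λ j₁ j₂ j₃ a₁ a₂ a₃ b₁ b₂ b₃ d₁ d₂ d₃ p₁ p₂ p₃ →
      let j = j₁ , j₂ , j₃ ; p = p₁ , p₂ , p₃ ; a = a₁ , a₂ , a₃ ; b = b₁ , b₂ , b₃ ; d = d₁ , d₂ , d₃ in
      (j :∙ (a :× d)) :* (p :∙ b) :=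
      (j :∙ (a :× b)) :* (p :∙ d) :+ (j :∙ (b :× d)) :* (p :∙ a) :- (a :∙ (b :× d)) :* (p :∙ j))
      refl j₁ j₂ j₃ a₁ a₂ a₃ b₁ b₂ b₃ d₁ d₂ d₃ p₁ p₂ p₃

  det-swapʳ : ∀ a b d → det a d b ≈ - det a b d
  det-swapʳ a b d = begin
    det a d b    ≈⟨ det-cycle a d b ⟩
    det d b a    ≈⟨ det-swap b d a ⟩
    - det b d a  ≈⟨ -‿cong (det-cycle a b d) ⟨
    - det a b d  ∎
    where open SetoidReasoning setoid

  signed : Bool → Vec3 → Vec3
  signed true v = negV v
  signed false v = v

  dot-signed-not : ∀ s a w → dot (signed (not s) a) w ≈ - dot (signed s a) w
  dot-signed-not false a w = dot-negˡ a w
  dot-signed-not true a w = sym (trans (-‿cong (dot-negˡ a w)) (-‿involutive _))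

  det-signed-nonzero : ∀ s a b d → ¬ (det a b d ≈ 0#) → ¬ (det (signed s a) b d ≈ 0#)
  det-signed-nonzero false a b d ≉0 = ≉0
  det-signed-nonzero true a b d ≉0 ≈0 = ≉0 (begin
    det a b d            ≈⟨ -‿involutive _ ⟨
    - - det a b d        ≈⟨ -‿cong (dot-negˡ a (cross b d)) ⟨
    - det (negV a) b d   ≈⟨ -‿cong ≈0 ⟩
    - 0#                 ≈⟨ -0#≈0# ⟩
    0#                   ∎)
    where open SetoidReasoning setoid

-- The three-valued signs of the statement

module Signs {c ℓ₁ ℓ₂} (R : OrderedCommutativeRing c ℓ₁ ℓ₂) where
  open OrderedRing R hiding (_+_)
  open Sphere R
  open Vectors R

  sign-positive : ∀ {x} → 0# < x → sign x ≡ pos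
  sign-positive {x} 0<x with compare x 0#
  ... | tri< _ _ ¬0<x = ⊥-elim (¬0<x 0<x)
  ... | tri≈ _ _ ¬0<x = ⊥-elim (¬0<x 0<x)
  ... | tri> _ _ _ = ≡.refl

  sign-negative : ∀ {x} → x < 0# → sign x ≡ neg
  sign-negative {x} x<0 with compare x 0#
  ... | tri< _ _ _ = ≡.refl
  ... | tri≈ ¬x<0 _ _ = ⊥-elim (¬x<0 x<0)
  ... | tri> ¬x<0 _ _ = ⊥-elim (¬x<0 x<0)

  negative : ∀ {x} → 0# < - x → x < 0#
  negative {x} 0<-x = <-respˡ-≈ (-‿involutive x) (positive⇒-negative 0<-x)

  positive-opposite : ∀ {s} → s ≡ pos → strictlyOpposite s neg ≢ false
  positive-opposite ≡.refl ()

  negative-opposite : ∀ {s} → s ≡ neg → strictlyOpposite s pos ≢ false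
  negative-opposite ≡.refl ()

  -- `strictlyOpposite` is false for a zero sign too. Excluding zero at `w` turns the closed
  -- condition of the statement into a strict one.
  same-side : ∀ s {a v w} → 0# < dot (signed s a) v → ¬ (dot a w ≈ 0#) →
    strictlyOpposite (sign (dot a v)) (sign (dot a w)) ≡ false → 0# < dot (signed s a) w
  same-side false {a} {v} {w} 0<v w≉0 eq with compare (dot a w) 0#
  ... | tri> _ _ 0<w = 0<w
  ... | tri≈ _ w≈0 _ = ⊥-elim (w≉0 w≈0)
  ... | tri< _ _ _ = ⊥-elim (positive-opposite (sign-positive 0<v) eq)
  same-side true {a} {v} {w} 0<v w≉0 eq with compare (dot a w) 0#
  ... | tri< w<0 _ _ = <-respʳ-≈ (sym (dot-negˡ a w)) (negative⇒-positive w<0)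
  ... | tri≈ _ w≈0 _ = ⊥-elim (w≉0 w≈0)
  ... | tri> _ _ _ = ⊥-elim (negative-opposite (sign-negative (negative (<-respʳ-≈ (dot-negˡ a v) 0<v))) eq)

  cross-negˡ : ∀ u a b → dot u (cross (negV a) b) ≈ - dot u (cross a b)
  cross-negˡ u a b = begin
    det u (negV a) b      ≈⟨ det-cycle u (negV a) b ⟩
    det (negV a) b u      ≈⟨ dot-negˡ a (cross b u) ⟩
    - det a b u           ≈⟨ -‿cong (det-cycle u a b) ⟨
    - det u a b           ∎
    where open SetoidReasoning setoid

  cross-negʳ : ∀ u a b → dot u (cross a (negV b)) ≈ - dot u (cross a b)
  cross-negʳ u a b = begin
    det u a (negV b)      ≈⟨ det-swapʳ u (negV b) a ⟩
    - det u (negV b) a    ≈⟨ -‿cong (cross-negˡ u b a) ⟩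
    - - det u b a         ≈⟨ -‿cong (det-swapʳ u b a) ⟨
    - det u a b           ∎
    where open SetoidReasoning setoid

module Combinatorics where
  open import Algebra.Properties.Semiring.Sum ℕₚ.+-*-semiring
    using (sum; sum-cong-≗; ∑-distrib-+; ∑-comm; *-distribˡ-sum; sum-replicate-zero)
  open import Data.Fin using (zero; suc; fromℕ<)
  open import Data.Fin.Properties using (suc-injective; pigeonhole; toℕ-fromℕ<)
  open import Data.List.Membership.DecPropositional using (_∈?_)
  open import Data.List.Properties using (map-cong-local)
  open import Data.List.Relation.Unary.Any.Properties using (lookup-index)
  open import Data.Nat using (zero; _+_; _*_; _∸_; _⊓_; _<_; _≡ᵇ_; _≤ᵇ_; _<ᵇ_)
  open import Relation.Binary.PropositionalEquality
    using (refl; sym; trans; subst₂; module ≡-Reasoning)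

  -- Finite sums

  ∑ : ∀ {n} → (Fin n → ℕ) → ℕ
  ∑ = sum

  ∑∑ : ∀ {n} → (Fin n → Fin n → ℕ) → ℕ
  ∑∑ f = ∑ (λ i → ∑ (f i))

  ∑-mono : ∀ {n} {f g : Fin n → ℕ} → (∀ i → f i ≤ g i) → ∑ f ≤ ∑ g
  ∑-mono {zero} f≤g = z≤n
  ∑-mono {suc n} f≤g = ℕₚ.+-mono-≤ (f≤g zero) (∑-mono (f≤g ∘ suc))

  ∑-vanishes : ∀ {n} {f : Fin n → ℕ} → (∀ i → f i ≡ 0) → ∑ f ≡ 0
  ∑-vanishes {n} f≡0 = trans (sum-cong-≗ f≡0) (sum-replicate-zero n)

  ∑∑-cong : ∀ {n} {f g : Fin n → Fin n → ℕ} → (∀ i j → f i j ≡ g i j) → ∑∑ f ≡ ∑∑ g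
  ∑∑-cong f≡g = sum-cong-≗ (λ i → sum-cong-≗ (f≡g i))

  ∑∑-mono : ∀ {n} {f g : Fin n → Fin n → ℕ} → (∀ i j → f i j ≤ g i j) → ∑∑ f ≤ ∑∑ g
  ∑∑-mono f≤g = ∑-mono (λ i → ∑-mono (f≤g i))

  ∑∑-distrib-+ : ∀ {n} (f g : Fin n → Fin n → ℕ) →
    ∑∑ (λ i j → f i j + g i j) ≡ ∑∑ f + ∑∑ g
  ∑∑-distrib-+ f g = trans (sum-cong-≗ (λ i → ∑-distrib-+ (f i) (g i)))
    (∑-distrib-+ (λ i → ∑ (f i)) (λ i → ∑ (g i)))

  *-distribˡ-∑∑ : ∀ {n} x (f : Fin n → Fin n → ℕ) → x * ∑∑ f ≡ ∑∑ (λ i j → x * f i j)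
  *-distribˡ-∑∑ x f = trans (*-distribˡ-sum x (λ i → ∑ (f i))) (sum-cong-≗ (λ i → *-distribˡ-sum x (f i)))

  -- The term is set to zero rather than removed, so that inductions stay in the same `Fin n`.
  without : ∀ {n} → Fin n → (Fin n → ℕ) → Fin n → ℕ
  without x f i = if does (i ≟ x) then 0 else f i

  without-≢ : ∀ {n} (x : Fin n) (f : Fin n → ℕ) {i} → x ≢ i → without x f i ≡ f i
  without-≢ x f {i} x≢i with i ≟ x
  ... | yes refl = ⊥-elim (x≢i refl)
  ... | no _ = refl

  ∑-without : ∀ {n} (x : Fin n) (f : Fin n → ℕ) → ∑ f ≡ f x + ∑ (without x f)
  ∑-without zero f = refl
  ∑-without (suc x) f = begin
    f zero + ∑ (f ∘ suc)                              ≡⟨ cong (f zero +_) (∑-without x (f ∘ suc)) ⟩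
    f zero + (f (suc x) + ∑ (without x (f ∘ suc)))    ≡⟨ ℕₚ.+-assoc (f zero) _ _ ⟨
    (f zero + f (suc x)) + ∑ (without x (f ∘ suc))    ≡⟨ cong (_+ ∑ (without x (f ∘ suc))) (ℕₚ.+-comm (f zero) _) ⟩
    (f (suc x) + f zero) + ∑ (without x (f ∘ suc))    ≡⟨ ℕₚ.+-assoc (f (suc x)) _ _ ⟩
    f (suc x) + (f zero + ∑ (without x (f ∘ suc)))    ≡⟨ cong (λ s → f (suc x) + (f zero + s)) (sum-cong-≗ shift) ⟩
    f (suc x) + ∑ (without (suc x) f)                 ∎
    where
    open ≡-Reasoning
    shift : ∀ i → without x (f ∘ suc) i ≡ without (suc x) f (suc i)
    shift i with i ≟ x
    ... | yes _ = refl
    ... | no _ = refl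

  ∑-≥-unique : ∀ {n} (f : Fin n → ℕ) {xs : List (Fin n)} → Unique xs →
    Listₙ.sum (List.map f xs) ≤ ∑ f
  ∑-≥-unique f [] = z≤n
  ∑-≥-unique f {x ∷ xs} (x∉xs ∷ unique) = begin
    f x + Listₙ.sum (List.map f xs)
      ≡⟨ cong (λ l → f x + Listₙ.sum l) (map-cong-local (All.map (λ ne → sym (without-≢ x f ne)) x∉xs)) ⟩
    f x + Listₙ.sum (List.map (without x f) xs)  ≤⟨ ℕₚ.+-monoʳ-≤ (f x) (∑-≥-unique (without x f) unique) ⟩
    f x + ∑ (without x f)                        ≡⟨ ∑-without x f ⟨
    ∑ f                                          ∎
    where open ℕₚ.≤-Reasoning

  ∑-≥ : ∀ {n} (f : Fin n → ℕ) x → f x ≤ ∑ f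
  ∑-≥ f x = ℕₚ.≤-trans (ℕₚ.m≤m+n (f x) 0) (∑-≥-unique f ([] ∷ []))

  -- Distinct first components put the entries into distinct rows. For corners of one face nothing
  -- is lost, since the first circle determines the second.
  ∑∑-≥-unique : ∀ {n} (f : Fin n → Fin n → ℕ) {es : List (Fin n × Fin n)} →
    Unique (List.map proj₁ es) → Listₙ.sum (List.map (λ (i , j) → f i j) es) ≤ ∑∑ f
  ∑∑-≥-unique f {es} unique =
    ℕₚ.≤-trans (rows es) (∑-≥-unique (λ i → ∑ (f i)) unique)
    where
    rows : ∀ es → Listₙ.sum (List.map (λ (i , j) → f i j) es) ≤
                  Listₙ.sum (List.map (λ i → ∑ (f i)) (List.map proj₁ es))
    rows [] = z≤n
    rows ((i , j) ∷ es) = ℕₚ.+-mono-≤ (∑-≥ (f i) j) (rows es)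

  nonzero-∑ : ∀ {n} (f : Fin n → ℕ) → 0 < ∑ f → ∃ λ i → 0 < f i
  nonzero-∑ {suc n} f 0<∑ with f zero in eq
  ... | suc _ = zero , subst (0 <_) (sym eq) (s≤s z≤n)
  ... | zero with nonzero-∑ (f ∘ suc) 0<∑
  ... | i , 0<fi = suc i , 0<fi

  ∑-≤1 : ∀ {n} (f : Fin n → ℕ) → (∀ i → f i ≤ 1) →
    (∀ i j → 0 < f i → 0 < f j → i ≡ j) → ∑ f ≤ 1
  ∑-≤1 {zero} f f≤1 unique = z≤n
  ∑-≤1 {suc n} f f≤1 unique with f zero in eq | f≤1 zero
  ... | zero | _ = ∑-≤1 (f ∘ suc) (f≤1 ∘ suc) (λ i j p q → suc-injective (unique (suc i) (suc j) p q))
  ... | suc zero | _ = s≤s (ℕₚ.≤-reflexive (∑-vanishes rest))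
    where
    rest : ∀ i → f (suc i) ≡ 0
    rest i with f (suc i) in eq′
    ... | zero = refl
    ... | suc _ with unique zero (suc i) (subst (0 <_) (sym eq) (s≤s z≤n)) (subst (0 <_) (sym eq′) (s≤s z≤n))
    ... | ()
  ... | suc (suc _) | s≤s ()

  ∑∑-≤1 : ∀ {n} (f : Fin n → Fin n → ℕ) → (∀ i j → f i j ≤ 1) →
    (∀ i j k l → 0 < f i j → 0 < f k l → i ≡ k × j ≡ l) → ∑∑ f ≤ 1
  ∑∑-≤1 f f≤1 unique = ∑-≤1 (λ i → ∑ (f i))
    (λ i → ∑-≤1 (f i) (f≤1 i) (λ j l p q → proj₂ (unique i j i l p q)))
    (λ i k p q → let j , p′ = nonzero-∑ (f i) p ; l , q′ = nonzero-∑ (f k) q in proj₁ (unique i j k l p′ q′))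

  -- Sums over all sign vectors

  -- Crossing circle `i`: the sign vector of a face becomes that of the place on the other side.
  flip : ∀ {n} → Fin n → Vec Bool n → Vec Bool n
  flip i σ = updateAt σ i not

  ∑ᵗ : ∀ {n} → (Vec Bool n → ℕ) → ℕ
  ∑ᵗ {zero} F = F []
  ∑ᵗ {suc n} F = ∑ᵗ (λ σ → F (false ∷ σ) + F (true ∷ σ))

  ∑ᵗ-mono : ∀ {n} {F G : Vec Bool n → ℕ} → (∀ σ → F σ ≤ G σ) → ∑ᵗ F ≤ ∑ᵗ G
  ∑ᵗ-mono {zero} F≤G = F≤G []
  ∑ᵗ-mono {suc n} F≤G = ∑ᵗ-mono {n} (λ σ → ℕₚ.+-mono-≤ (F≤G (false ∷ σ)) (F≤G (true ∷ σ)))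

  ∑ᵗ-cong : ∀ {n} {F G : Vec Bool n → ℕ} → (∀ σ → F σ ≡ G σ) → ∑ᵗ F ≡ ∑ᵗ G
  ∑ᵗ-cong {zero} F≡G = F≡G []
  ∑ᵗ-cong {suc n} F≡G = ∑ᵗ-cong {n} (λ σ → cong₂ _+_ (F≡G (false ∷ σ)) (F≡G (true ∷ σ)))

  ∑ᵗ-mono-< : ∀ {n} {F G : Vec Bool n → ℕ} → (∀ σ → F σ ≤ G σ) → ∀ τ → F τ < G τ → ∑ᵗ F < ∑ᵗ G
  ∑ᵗ-mono-< {zero} F≤G [] Fτ<Gτ = Fτ<Gτ
  ∑ᵗ-mono-< {suc n} F≤G (false ∷ τ) Fτ<Gτ =
    ∑ᵗ-mono-< (λ σ → ℕₚ.+-mono-≤ (F≤G (false ∷ σ)) (F≤G (true ∷ σ))) τ (ℕₚ.+-mono-<-≤ Fτ<Gτ (F≤G _))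
  ∑ᵗ-mono-< {suc n} F≤G (true ∷ τ) Fτ<Gτ =
    ∑ᵗ-mono-< (λ σ → ℕₚ.+-mono-≤ (F≤G (false ∷ σ)) (F≤G (true ∷ σ))) τ (ℕₚ.+-mono-≤-< (F≤G _) Fτ<Gτ)

  ∑ᵗ-distrib-+ : ∀ {n} (F G : Vec Bool n → ℕ) → ∑ᵗ (λ σ → F σ + G σ) ≡ ∑ᵗ F + ∑ᵗ G
  ∑ᵗ-distrib-+ {zero} F G = refl
  ∑ᵗ-distrib-+ {suc n} F G = trans
    (∑ᵗ-cong {n} (λ σ → solve 4 (λ a b c d → (a :+ b) :+ (c :+ d) := (a :+ c) :+ (b :+ d)) refl
      (F (false ∷ σ)) (G (false ∷ σ)) (F (true ∷ σ)) (G (true ∷ σ))))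
    (∑ᵗ-distrib-+ {n} _ _)
    where open +-*-Solver

  *-distribˡ-∑ᵗ : ∀ {n} x (F : Vec Bool n → ℕ) → x * ∑ᵗ F ≡ ∑ᵗ (λ σ → x * F σ)
  *-distribˡ-∑ᵗ {zero} x F = refl
  *-distribˡ-∑ᵗ {suc n} x F = trans (*-distribˡ-∑ᵗ {n} x _)
    (∑ᵗ-cong {n} (λ σ → ℕₚ.*-distribˡ-+ x (F (false ∷ σ)) (F (true ∷ σ))))

  ∑ᵗ-flip : ∀ {n} (i : Fin n) (F : Vec Bool n → ℕ) → ∑ᵗ (F ∘ flip i) ≡ ∑ᵗ F
  ∑ᵗ-flip zero F = ∑ᵗ-cong (λ σ → ℕₚ.+-comm (F (true ∷ σ)) (F (false ∷ σ)))
  ∑ᵗ-flip (suc i) F = ∑ᵗ-flip i _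

  ∑-∑ᵗ-comm : ∀ {m n} (F : Fin m → Vec Bool n → ℕ) →
    ∑ (λ i → ∑ᵗ (F i)) ≡ ∑ᵗ (λ σ → ∑ (λ i → F i σ))
  ∑-∑ᵗ-comm {n = zero} F = refl
  ∑-∑ᵗ-comm {n = suc n} F = trans (∑-∑ᵗ-comm {n = n} (λ i σ → F i (false ∷ σ) + F i (true ∷ σ)))
    (∑ᵗ-cong (λ σ → ∑-distrib-+ (λ i → F i (false ∷ σ)) (λ i → F i (true ∷ σ))))

  indicator : ∀ {p} {P : Set p} → Dec P → ℕ
  indicator (yes _) = 1
  indicator (no _) = 0

  indicator-yes : ∀ {p} {P : Set p} (d : Dec P) → P → indicator d ≡ 1
  indicator-yes (yes _) p = refl
  indicator-yes (no ¬p) p = ⊥-elim (¬p p)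

  indicator⁻¹ : ∀ {p} {P : Set p} (d : Dec P) → 0 < indicator d → P
  indicator⁻¹ (yes p) _ = p

  indicator-≤1 : ∀ {p} {P : Set p} (d : Dec P) → indicator d ≤ 1
  indicator-≤1 (yes _) = s≤s z≤n
  indicator-≤1 (no _) = z≤n

  indicator-iff : ∀ {p q} {P : Set p} {Q : Set q} (d : Dec P) (e : Dec Q) →
    (P → Q) → (Q → P) → indicator d ≡ indicator e
  indicator-iff (yes p) e to from = sym (indicator-yes e (to p))
  indicator-iff (no ¬p) (yes q) to from = ⊥-elim (¬p (from q))
  indicator-iff (no _) (no _) to from = refl

  -- Oriented arrangements and their corners

  -- An arrangement seen through all its reorientations: `positive σ i j k` is the
  -- sign of the determinant of the normals i, j, k after negating those marked in σ.
  record OrientedArrangement (n : ℕ) : Set where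
    field
      positive  : Vec Bool n → Fin n → Fin n → Fin n → Bool
      cycle     : ∀ σ i j k → positive σ i j k ≡ positive σ j k i
      swap      : ∀ σ {i j k} → i ≢ j → j ≢ k → i ≢ k →
                  positive σ j i k ≡ not (positive σ i j k)
      negate    : ∀ σ {i j k} → i ≢ j → j ≢ k → i ≢ k →
                  positive (Vec.map not σ) i j k ≡ not (positive σ i j k)
      flip-at   : ∀ σ {i j k} → i ≢ j → j ≢ k → i ≢ k →
                  positive (flip i σ) i j k ≡ not (positive σ i j k)
      flip-away : ∀ σ {i j k m} → i ≢ m → j ≢ m → k ≢ m →
                  positive (flip m σ) i j k ≡ positive σ i j k
      transitive : ∀ σ i j {a b c} →
                  positive σ i j a ≡ true → positive σ i j b ≡ true → positive σ i j c ≡ true →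
                  positive σ j a b ≡ true → positive σ j b c ≡ true → positive σ j a c ≡ true

    -- The face with sign vector σ has a corner in which its boundary, traversed
    -- counterclockwise, passes from circle i to circle j.  The corner sits at the
    -- vertex ± (L i × L j), the sign being + exactly when σ agrees at i and j.
    Corner : Vec Bool n → Fin n → Fin n → Set
    Corner σ i j = i ≢ j × (∀ m → m ≢ i → m ≢ j → positive σ i j m ≡ true)

    corner? : ∀ σ i j → Dec (Corner σ i j)
    corner? σ i j = ¬? (i ≟ j) ×-dec all? (λ m →
      ¬? (m ≟ i) →-dec ¬? (m ≟ j) →-dec (positive σ i j m 𝔹.≟ true))

    corners : Vec Bool n → Fin n → Fin n → ℕ
    corners σ i j = indicator (corner? σ i j)

    field
      -- The circles around a point of the face p, oriented to turn the same way
      -- about that point, leave at most one corner of each face between two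
      -- forward directions.
      forward-unique : ∀ {p a b c d} → Corner p a b → Corner p b c → Corner p c d → a ≢ c → b ≢ d →
        ∀ {σ i j k l} → Corner σ i j → Corner σ k l →
        lookup σ i ≢ lookup p i → lookup σ j ≡ lookup p j →
        lookup σ k ≢ lookup p k → lookup σ l ≡ lookup p l → i ≡ k × j ≡ l

    size : Vec Bool n → ℕ
    size σ = ∑∑ (corners σ)

  flip-involutive : ∀ {n} (i : Fin n) σ → flip i (flip i σ) ≡ σ
  flip-involutive i σ = trans (Vecₚ.updateAt-updateAt i σ)
    (Vecₚ.updateAt-id-local i σ (𝔹.not-involutive (lookup σ i)))

  flip-comm : ∀ {n} (i j : Fin n) σ → flip i (flip j σ) ≡ flip j (flip i σ)
  flip-comm i j σ with i ≟ j
  ... | yes refl = refl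
  ... | no i≢j = Vecₚ.updateAt-commutes i j i≢j σ

  -- Pigeonhole. The circle found here is the one that refutes a configuration closed up by too few
  -- circles.
  fresh : ∀ {n} (xs : List (Fin n)) → length xs < n → ∃ λ m → m ∉ xs
  fresh {n} xs short = Finₚ.¬∀⟶∃¬ n (_∈ xs) (λ m → _∈?_ _≟_ m xs) impossible
    where
    impossible : ¬ (∀ m → m ∈ xs)
    impossible all∈ with pigeonhole short (index ∘ all∈)
    ... | i , j , i<j , eq = Finₚ.<⇒≢ i<j (begin
      i                                ≡⟨ lookup-index (all∈ i) ⟩
      List.lookup xs (index (all∈ i))  ≡⟨ cong (List.lookup xs) eq ⟩
      List.lookup xs (index (all∈ j))  ≡⟨ lookup-index (all∈ j) ⟨
      j                                ∎)
      where open ≡-Reasoning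

  -- Boundaries of faces and positions of triangles

  module Faces {n} (arrangement : OrientedArrangement n) (5≤n : 5 ≤ n) where
    open OrientedArrangement arrangement

    swap-last : ∀ σ {i j k} → i ≢ j → j ≢ k → i ≢ k → positive σ i k j ≡ not (positive σ i j k)
    swap-last σ {i} {j} {k} i≢j j≢k i≢k = begin
      positive σ i k j        ≡⟨ cycle σ i k j ⟩
      positive σ k j i        ≡⟨ swap σ j≢k (i≢k ∘ sym) (i≢j ∘ sym) ⟩
      not (positive σ j k i)  ≡⟨ cong not (cycle σ i j k) ⟨
      not (positive σ i j k)  ∎
      where open ≡-Reasoning

    opposed : ∀ {a b} → a ≡ true → b ≡ true → a ≡ not b → ⊥
    opposed refl refl ()

    negative⇒positive : ∀ {a b} → a ≡ false → b ≡ not a → b ≡ true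
    negative⇒positive refl refl = refl

    not-not : ∀ {a b c} → c ≡ true → b ≡ not c → a ≡ not b → a ≡ true
    not-not refl refl refl = refl

    -- Each of two candidates would have to come before the other on circle `i`, but exchanging them
    -- changes the sign.
    next-unique : ∀ {σ i j k} → Corner σ i j → Corner σ i k → j ≡ k
    next-unique {σ} {i} {j} {k} (i≢j , left-j) (i≢k , left-k) with j ≟ k
    ... | yes j≡k = j≡k
    ... | no j≢k = ⊥-elim (opposed (left-k j (i≢j ∘ sym) j≢k) (left-j k (i≢k ∘ sym) (j≢k ∘ sym))
                                   (swap-last σ i≢j j≢k i≢k))

    -- The two vertices of a digon are antipodal, so no third circle has both on its positive side.
    no-digon : ∀ {σ i j} → Corner σ i j → ¬ Corner σ j i
    no-digon {σ} {i} {j} (i≢j , left-ij) (_ , left-ji)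
      with fresh (i ∷ j ∷ []) (ℕₚ.≤-trans (s≤s (s≤s (s≤s z≤n))) 5≤n)
    ... | m , m∉ = opposed (left-ji m m≢j m≢i) (left-ij m m≢i m≢j) (swap σ i≢j (m≢j ∘ sym) (m≢i ∘ sym))
      where
      m≢i : m ≢ i
      m≢i = m∉ ∘ here
      m≢j : m ≢ j
      m≢j = m∉ ∘ there ∘ here

    -- The next circle is the first one met on circle j; being first is a minimum
    -- of a total order because all candidates lie on one side of circle i.
    next-among : ∀ {σ i j} → Corner σ i j → (xs : List (Fin n)) →
      ∃ λ k → k ≢ i × k ≢ j × (∀ {m} → m ∈ xs → m ≢ i → m ≢ j → m ≢ k → positive σ j k m ≡ true)
    next-among {σ} {i} {j} (i≢j , left) []
      with fresh (i ∷ j ∷ []) (ℕₚ.≤-trans (s≤s (s≤s (s≤s z≤n))) 5≤n)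
    ... | k , k∉ = k , k∉ ∘ here , k∉ ∘ there ∘ here , λ ()
    next-among {σ} {i} {j} c@(i≢j , left) (x ∷ xs)
      with next-among c xs | x ≟ i | x ≟ j
    ... | k , k≢i , k≢j , first | yes refl | _ =
      k , k≢i , k≢j , λ { (here refl) m≢i _ _ → ⊥-elim (m≢i refl) ; (there m∈) → first m∈ }
    ... | k , k≢i , k≢j , first | no _ | yes refl =
      k , k≢i , k≢j , λ { (here refl) _ m≢j _ → ⊥-elim (m≢j refl) ; (there m∈) → first m∈ }
    ... | k , k≢i , k≢j , first | no x≢i | no x≢j with x ≟ k
    ... | yes refl =
      k , k≢i , k≢j , λ { (here refl) _ _ m≢k → ⊥-elim (m≢k refl) ; (there m∈) → first m∈ }
    ... | no x≢k with positive σ j k x in eq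
    ... | true = k , k≢i , k≢j , λ { (here refl) _ _ _ → eq ; (there m∈) → first m∈ }
    ... | false = x , x≢i , x≢j , λ
      { (here refl) _ _ m≢x → ⊥-elim (m≢x refl)
      ; {m} (there m∈) m≢i m≢j m≢x → beyond m∈ m≢i m≢j m≢x }
      where
      jxk : positive σ j x k ≡ true
      jxk = negative⇒positive eq (swap-last σ (k≢j ∘ sym) (x≢k ∘ sym) (x≢j ∘ sym))
      beyond : ∀ {m} → m ∈ xs → m ≢ i → m ≢ j → m ≢ x → positive σ j x m ≡ true
      beyond {m} m∈ m≢i m≢j m≢x with m ≟ k
      ... | yes refl = jxk
      ... | no m≢k = transitive σ i j (left x x≢i x≢j) (left k k≢i k≢j) (left m m≢i m≢j)
                       jxk (first m∈ m≢i m≢j m≢k)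

    next : ∀ {σ i j} → Corner σ i j → ∃ λ k → Corner σ j k
    next {σ} {i} {j} c@(i≢j , left) with next-among c (allFin n)
    ... | k , k≢i , k≢j , first = k , k≢j ∘ sym , left′
      where
      left′ : ∀ m → m ≢ j → m ≢ k → positive σ j k m ≡ true
      left′ m m≢j m≢k with m ≟ i
      ... | yes refl = trans (sym (cycle σ i j k)) (left k k≢i k≢j)
      ... | no m≢i = first (∈-allFin m) m≢i m≢j m≢k

    -- The antipodal map reverses every sign and the order in which the boundary meets the circles.
    -- It thereby turns `next` into `previous`.
    antipodal : ∀ {σ i j} → Corner σ i j → Corner (Vec.map not σ) j i
    antipodal {σ} {i} {j} (i≢j , left) = i≢j ∘ sym , λ m m≢j m≢i →
      not-not (left m m≢i m≢j) (swap σ i≢j (m≢j ∘ sym) (m≢i ∘ sym))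
        (negate σ (i≢j ∘ sym) (m≢i ∘ sym) (m≢j ∘ sym))

    previous : ∀ {σ i j} → Corner σ i j → ∃ λ h → Corner σ h i
    previous {σ} c with next (antipodal c)
    ... | h , c′ = h , subst (λ τ → Corner τ h _) (begin
        Vec.map not (Vec.map not σ)  ≡⟨ Vecₚ.map-∘ not not σ ⟨
        Vec.map (not ∘ not) σ        ≡⟨ Vecₚ.map-cong 𝔹.not-involutive σ ⟩
        Vec.map (λ b → b) σ          ≡⟨ Vecₚ.map-id σ ⟩
        σ                            ∎) (antipodal c′)
      where open ≡-Reasoning

    -- Negating the normal of `i` and exchanging the factors leave the vector product unchanged:
    -- neighbouring faces share the vertex and pass through its circles in opposite order.
    flip-in : ∀ {σ i j} → Corner σ i j → Corner (flip i σ) j i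
    flip-in {σ} {i} {j} (i≢j , left) = i≢j ∘ sym , λ m m≢j m≢i →
      trans (cycle (flip i σ) j i m)
        (not-not (left m m≢i m≢j) (swap-last σ i≢j (m≢j ∘ sym) (m≢i ∘ sym))
          (flip-at σ (m≢i ∘ sym) m≢j i≢j))

    flip-out : ∀ {σ i j} → Corner σ i j → Corner (flip j σ) j i
    flip-out {σ} {i} {j} (i≢j , left) = i≢j ∘ sym , λ m m≢j m≢i →
      not-not (left m m≢i m≢j) (swap σ i≢j (m≢j ∘ sym) (m≢i ∘ sym))
        (flip-at σ (i≢j ∘ sym) (m≢i ∘ sym) (m≢j ∘ sym))

    flip-both : ∀ {σ i j} → Corner σ i j → Corner (flip i (flip j σ)) i j
    flip-both c = flip-out (flip-out c)

    corners-Corner : ∀ {σ i j} → Corner σ i j → corners σ i j ≡ 1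
    corners-Corner {σ} {i} {j} = indicator-yes (corner? σ i j)

    Corner-corners : ∀ {σ i j} → 0 < corners σ i j → Corner σ i j
    Corner-corners {σ} {i} {j} = indicator⁻¹ (corner? σ i j)

    corners-≤1 : ∀ σ i j → corners σ i j ≤ 1
    corners-≤1 σ i j = indicator-≤1 (corner? σ i j)

    corners-flip : ∀ σ i j → corners (flip i σ) j i ≡ corners σ i j
    corners-flip σ i j = indicator-iff (corner? (flip i σ) j i) (corner? σ i j)
      (λ c → subst (λ τ → Corner τ i j) (flip-involutive i σ) (flip-out c)) flip-in

    size-≥ : ∀ {σ} {es : List (Fin n × Fin n)} → All (λ (i , j) → Corner σ i j) es →
      Unique (List.map proj₁ es) → length es ≤ size σ
    size-≥ {σ} {es} cs unique = subst (_≤ size σ) (total cs) (∑∑-≥-unique (corners σ) unique)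
      where
      total : ∀ {es} → All (λ (i , j) → Corner σ i j) es →
        Listₙ.sum (List.map (λ (i , j) → corners σ i j) es) ≡ length es
      total [] = refl
      total (c ∷ cs) = cong₂ _+_ (corners-Corner c) (total cs)

    size-≥3 : ∀ {σ i j} → Corner σ i j → 3 ≤ size σ
    size-≥3 ij with next ij
    ... | k , jk with next jk
    ... | l , kl = size-≥ (ij ∷ jk ∷ kl ∷ [])
      ((proj₁ ij ∷ (λ { refl → no-digon ij jk }) ∷ []) ∷ (proj₁ jk ∷ []) ∷ [] ∷ [])

    -- Otherwise the walk along the boundary has four corners with distinct first circles.
    triangle-closes : ∀ {σ i j k} → size σ ≡ 3 → Corner σ i j → Corner σ j k → Corner σ k i
    triangle-closes {σ} {i} size≡3 ij jk with next jk
    ... | l , kl with l ≟ i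
    ... | yes refl = kl
    ... | no l≢i with next kl
    ... | m , lm = contradiction four (ℕₚ.<⇒≱ (ℕₚ.≤-reflexive (cong suc size≡3)))
      where
      four : 4 ≤ size σ
      four = size-≥ (ij ∷ jk ∷ kl ∷ lm ∷ [])
        ((proj₁ ij ∷ (λ { refl → no-digon ij jk }) ∷ l≢i ∘ sym ∷ []) ∷
         (proj₁ jk ∷ (λ { refl → no-digon jk kl }) ∷ []) ∷
         (proj₁ kl ∷ []) ∷ [] ∷ [])

    reversed-⊥ : ∀ {σ i j m} → i ≢ j → m ≢ i → m ≢ j → positive σ i j m ≡ true → positive σ j i m ≡ true → ⊥
    reversed-⊥ {σ} i≢j m≢i m≢j p q = opposed q p (swap σ i≢j (m≢j ∘ sym) (m≢i ∘ sym))

    -- Glued along `j`, the triangles form a lune of the circles `i` and `k` that meets only `j`.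
    -- Its ends are antipodal, so a fourth circle separates them, whereas both triangles demand the
    -- positive side of it.
    no-triangle-across-out : ∀ {σ i j} → Corner σ i j → size σ ≡ 3 → size (flip j σ) ≢ 3
    no-triangle-across-out {σ} {i} {j} ij σ≡3 σʲ≡3 with next ij
    ... | k , jk with fresh (i ∷ j ∷ k ∷ []) (ℕₚ.≤-trans (s≤s (s≤s (s≤s (s≤s z≤n)))) 5≤n)
    ... | m , m∉ = reversed-⊥ (proj₁ ki) m≢k m≢i (proj₂ ki m m≢k m≢i)
        (trans (sym (flip-away σ (proj₁ ij) (proj₁ jk ∘ sym) m≢j)) (proj₂ ik m m≢i m≢k))
      where
      m≢i : m ≢ i
      m≢i = m∉ ∘ here
      m≢j : m ≢ j
      m≢j = m∉ ∘ there ∘ here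
      m≢k : m ≢ k
      m≢k = m∉ ∘ there ∘ there ∘ here
      ki : Corner σ k i
      ki = triangle-closes σ≡3 ij jk
      ik : Corner (flip j σ) i k
      ik = triangle-closes σʲ≡3 (flip-in jk) (flip-out ij)

    no-triangle-across-in : ∀ {σ i j} → Corner σ i j → size σ ≡ 3 → size (flip i σ) ≢ 3
    no-triangle-across-in ij = no-triangle-across-out (proj₂ (previous ij))

    -- Triangles across opposite sides a, k of a quadrilateral would both contain
    -- the crossing of the other two sides, leaving only four circles.
    no-opposite-triangles : ∀ {τ k b a} → size τ ≡ 4 → Corner τ k b → Corner τ b a →
      size (flip k τ) ≡ 3 → size (flip a τ) ≢ 3
    no-opposite-triangles {τ} {k} {b} {a} τ≡4 kb ba τᵏ≡3 τᵃ≡3 with next ba | previous kb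
    ... | l , al | q , qk = absurd
      where
      bl : Corner (flip a τ) b l
      bl = triangle-closes τᵃ≡3 (flip-in al) (flip-out ba)
      qb : Corner (flip k τ) q b
      qb = triangle-closes τᵏ≡3 (flip-in kb) (flip-out qk)
      absurd : ⊥
      -- The boundary of `τ` runs through `q`, `k`, `b`, `a`, `l`. In a genuine quadrilateral `q` is
      -- `l`; the degenerate case `l = k` and the case of five distinct circles are refuted
      -- separately.
      absurd with fresh (a ∷ b ∷ k ∷ l ∷ []) 5≤n | l ≟ k | q ≟ l
      ... | m , m∉ | yes refl | _ = reversed-⊥ (proj₁ kb) (m∉ ∘ there ∘ there ∘ here) (m∉ ∘ there ∘ here)
        (proj₂ kb m (m∉ ∘ there ∘ there ∘ here) (m∉ ∘ there ∘ here))
        (trans (sym (flip-away τ (proj₁ ba) (proj₁ al ∘ sym) (m∉ ∘ here)))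
          (proj₂ bl m (m∉ ∘ there ∘ here) (m∉ ∘ there ∘ there ∘ here)))
      ... | m , m∉ | no l≢k | yes refl = reversed-⊥ (proj₁ bl) (m∉ ∘ there ∘ here) (m∉ ∘ there ∘ there ∘ there ∘ here)
        (trans (sym (flip-away τ (proj₁ ba) (proj₁ al ∘ sym) (m∉ ∘ here)))
          (proj₂ bl m (m∉ ∘ there ∘ here) (m∉ ∘ there ∘ there ∘ there ∘ here)))
        (trans (sym (flip-away τ l≢k (proj₁ kb ∘ sym) (m∉ ∘ there ∘ there ∘ here)))
          (proj₂ qb m (m∉ ∘ there ∘ there ∘ there ∘ here) (m∉ ∘ there ∘ here)))
      ... | m , m∉ | no l≢k | no q≢l with next al
      ... | r , lr = contradiction five (ℕₚ.<⇒≱ (ℕₚ.≤-reflexive (cong suc τ≡4)))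
        where
        five : 5 ≤ size τ
        five = size-≥ (qk ∷ kb ∷ ba ∷ al ∷ lr ∷ [])
          ((proj₁ qk ∷ (λ { refl → no-digon qk kb }) ∷ (λ { refl → l≢k (next-unique al qk) }) ∷ q≢l ∷ []) ∷
           (proj₁ kb ∷ (λ { refl → no-digon kb ba }) ∷ l≢k ∘ sym ∷ []) ∷
           (proj₁ ba ∷ (λ { refl → no-digon ba al }) ∷ []) ∷
           (proj₁ al ∷ []) ∷ [] ∷ [])

  -- Numerical part of the discharging

  -- In units of 1/420, what a face of size s gives at one of its corners: the even
  -- share 420 (s - 4) / s, cut off at 210, except that a heptagon modulates 180 by
  -- ± 30 according to `special` and `ahead` below.
  weight : ℕ → ℕ → ℕ → ℕ
  weight 5 _ _ = 84
  weight 6 _ _ = 140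
  weight 7 s f = 150 + 30 * (s + f)
  weight (suc (suc (suc (suc (suc (suc (suc (suc _)))))))) _ _ = 210
  weight _ _ _ = 0

  weight-mono : ∀ k {s s′ f f′} → s ≤ s′ → f ≤ f′ → weight k s f ≤ weight k s′ f′
  weight-mono 0 _ _ = z≤n
  weight-mono 1 _ _ = z≤n
  weight-mono 2 _ _ = z≤n
  weight-mono 3 _ _ = z≤n
  weight-mono 4 _ _ = z≤n
  weight-mono 5 _ _ = ℕₚ.≤-refl
  weight-mono 6 _ _ = ℕₚ.≤-refl
  weight-mono 7 p q = ℕₚ.+-monoʳ-≤ 150 (ℕₚ.*-monoʳ-≤ 30 (ℕₚ.+-mono-≤ p q))
  weight-mono (suc (suc (suc (suc (suc (suc (suc (suc _)))))))) _ _ = ℕₚ.≤-refl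

  -- Doubled, so that two opposite triangles can share equally in integers.
  gift : ℕ → ℕ → ℕ → ℕ → ℕ
  gift o x y z = if o ≡ᵇ 3 then x + y else 2 * (x + y + z)

  gift-mono : ∀ o {x x′ y y′ z z′} → x ≤ x′ → y ≤ y′ → z ≤ z′ → gift o x y z ≤ gift o x′ y′ z′
  gift-mono o p q r with o ≡ᵇ 3
  ... | true = ℕₚ.+-mono-≤ p q
  ... | false = ℕₚ.*-monoʳ-≤ 2 (ℕₚ.+-mono-≤ (ℕₚ.+-mono-≤ p q) r)

  -- Lower bound, in terms of sizes alone, for what a triangle receives at a vertex
  -- where the other faces are a and b (across its edges) and o (opposite).
  gift-bound : ℕ → ℕ → ℕ → ℕ
  gift-bound a b o = gift o
    (weight a 0 1)
    (weight b 0 (if o ≡ᵇ 4 then 0 else 1))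
    (if (b ≡ᵇ 4) ∧ (a ≡ᵇ 4) then weight o 1 1 else weight o 0 (if a ≡ᵇ 4 then 0 else 1))

  -- The sizes opposite to the three vertices of a triangle are bounded independently of each other,
  -- so each is minimised separately and only the neighbours' sizes remain coupled. The initial
  -- value 840 is the doubled unit that a whole triangle needs, hence no harmful cap for one corner.
  least-gift : ℕ → ℕ → ℕ
  least-gift a b =
    foldr (λ o m → if 15 ≤ᵇ a + b + o then gift-bound a b o ⊓ m else m) 840 (3 ∷ 4 ∷ 5 ∷ 6 ∷ 7 ∷ 8 ∷ [])

  least-gift-check : ∀ (a b o : Fin 9) → 4 ≤ toℕ a → 4 ≤ toℕ b → 3 ≤ toℕ o →
    15 ≤ toℕ a + toℕ b + toℕ o → least-gift (toℕ a) (toℕ b) ≤ gift-bound (toℕ a) (toℕ b) (toℕ o)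
  least-gift-check = from-yes (all? λ (a : Fin 9) → all? λ (b : Fin 9) → all? λ (o : Fin 9) →
    (4 ℕ.≤? toℕ a) →-dec (4 ℕ.≤? toℕ b) →-dec (3 ℕ.≤? toℕ o) →-dec
    (15 ℕ.≤? toℕ a + toℕ b + toℕ o) →-dec
    (least-gift (toℕ a) (toℕ b) ℕ.≤? gift-bound (toℕ a) (toℕ b) (toℕ o)))

  -- The bound is attained at sizes 4, 4, 8: the vertex between the quadrilaterals brings 420, and
  -- each of the other two brings 210 when a triangle lies opposite.
  triangle-check : ∀ (a b c : Fin 9) → 4 ≤ toℕ a → 4 ≤ toℕ b → 4 ≤ toℕ c →
    840 ≤ least-gift (toℕ a) (toℕ b) + least-gift (toℕ b) (toℕ c) + least-gift (toℕ c) (toℕ a)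
  triangle-check = from-yes (all? λ (a : Fin 9) → all? λ (b : Fin 9) → all? λ (c : Fin 9) →
    (4 ℕ.≤? toℕ a) →-dec (4 ℕ.≤? toℕ b) →-dec (4 ℕ.≤? toℕ c) →-dec
    (840 ℕ.≤? least-gift (toℕ a) (toℕ b) + least-gift (toℕ b) (toℕ c) + least-gift (toℕ c) (toℕ a)))

  cap : ℕ → ℕ
  cap = _⊓ 8

  capped : ∀ a → ∃ λ (c : Fin 9) → toℕ c ≡ cap a
  capped a = fromℕ< (s≤s (ℕₚ.m⊓n≤n a 8)) , toℕ-fromℕ< _

  cap-≥ : ∀ {k a} → k ≤ 8 → k ≤ a → k ≤ cap a
  cap-≥ k≤8 k≤a = ℕₚ.⊓-glb k≤a k≤8

  weight-cap : ∀ a s f → weight (cap a) s f ≡ weight a s f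
  weight-cap 0 _ _ = refl
  weight-cap 1 _ _ = refl
  weight-cap 2 _ _ = refl
  weight-cap 3 _ _ = refl
  weight-cap 4 _ _ = refl
  weight-cap 5 _ _ = refl
  weight-cap 6 _ _ = refl
  weight-cap 7 _ _ = refl
  weight-cap (suc (suc (suc (suc (suc (suc (suc (suc _)))))))) _ _ = refl

  cap-≡ᵇ4 : ∀ a → (cap a ≡ᵇ 4) ≡ (a ≡ᵇ 4)
  cap-≡ᵇ4 0 = refl
  cap-≡ᵇ4 1 = refl
  cap-≡ᵇ4 2 = refl
  cap-≡ᵇ4 3 = refl
  cap-≡ᵇ4 4 = refl
  cap-≡ᵇ4 (suc (suc (suc (suc (suc zero))))) = refl
  cap-≡ᵇ4 (suc (suc (suc (suc (suc (suc zero)))))) = refl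
  cap-≡ᵇ4 (suc (suc (suc (suc (suc (suc (suc zero))))))) = refl
  cap-≡ᵇ4 (suc (suc (suc (suc (suc (suc (suc (suc _)))))))) = refl

  cap-≡ᵇ3 : ∀ a → (cap a ≡ᵇ 3) ≡ (a ≡ᵇ 3)
  cap-≡ᵇ3 0 = refl
  cap-≡ᵇ3 1 = refl
  cap-≡ᵇ3 2 = refl
  cap-≡ᵇ3 3 = refl
  cap-≡ᵇ3 4 = refl
  cap-≡ᵇ3 (suc (suc (suc (suc (suc zero))))) = refl
  cap-≡ᵇ3 (suc (suc (suc (suc (suc (suc zero)))))) = refl
  cap-≡ᵇ3 (suc (suc (suc (suc (suc (suc (suc zero))))))) = refl
  cap-≡ᵇ3 (suc (suc (suc (suc (suc (suc (suc (suc _)))))))) = refl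

  gift-bound-cap : ∀ a b o → gift-bound (cap a) (cap b) (cap o) ≡ gift-bound a b o
  gift-bound-cap a b o
    rewrite cap-≡ᵇ4 a | cap-≡ᵇ4 b | cap-≡ᵇ4 o | cap-≡ᵇ3 o | weight-cap a 0 1
          | weight-cap b 0 (if o ≡ᵇ 4 then 0 else 1) | weight-cap o 1 1
          | weight-cap o 0 (if a ≡ᵇ 4 then 0 else 1) = refl

  -- As soon as one size reaches 8, the least possible values 4 and 3 of the others complete it to
  -- at least 15. Hence sizes can be cut off at 8, from where on the weights are constant as well.
  cap-sum : ∀ {a b o} → 4 ≤ a → 4 ≤ b → 3 ≤ o → 15 ≤ a + b + o → 15 ≤ cap a + cap b + cap o
  cap-sum {a} {b} {o} 4≤a 4≤b 3≤o 15≤ with ℕₚ.≤-total a 8 | ℕₚ.≤-total b 8 | ℕₚ.≤-total o 8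
  ... | inj₂ 8≤a | _ | _ =
    ℕₚ.+-mono-≤ (ℕₚ.+-mono-≤ (cap-≥ ℕₚ.≤-refl 8≤a) (cap-≥ (ℕₚ.m≤m+n 4 4) 4≤b)) (cap-≥ (ℕₚ.m≤m+n 3 5) 3≤o)
  ... | inj₁ _ | inj₂ 8≤b | _ =
    ℕₚ.+-mono-≤ (ℕₚ.+-mono-≤ (cap-≥ (ℕₚ.m≤m+n 4 4) 4≤a) (cap-≥ ℕₚ.≤-refl 8≤b)) (cap-≥ (ℕₚ.m≤m+n 3 5) 3≤o)
  ... | inj₁ _ | inj₁ _ | inj₂ 8≤o = ℕₚ.≤-trans (ℕₚ.m≤m+n 15 1)
    (ℕₚ.+-mono-≤ (ℕₚ.+-mono-≤ (cap-≥ (ℕₚ.m≤m+n 4 4) 4≤a) (cap-≥ (ℕₚ.m≤m+n 4 4) 4≤b)) (cap-≥ ℕₚ.≤-refl 8≤o))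
  ... | inj₁ a≤8 | inj₁ b≤8 | inj₁ o≤8
    rewrite ℕₚ.m≤n⇒m⊓n≡m a≤8 | ℕₚ.m≤n⇒m⊓n≡m b≤8 | ℕₚ.m≤n⇒m⊓n≡m o≤8 = 15≤

  least-gift-≤ : ∀ {a b o} → 4 ≤ a → 4 ≤ b → 3 ≤ o → 15 ≤ a + b + o →
    least-gift (cap a) (cap b) ≤ gift-bound a b o
  least-gift-≤ {a} {b} {o} 4≤a 4≤b 3≤o 15≤ = subst (least-gift (cap a) (cap b) ≤_) (gift-bound-cap a b o)
    (check (proj₂ (capped a)) (proj₂ (capped b)) (proj₂ (capped o))
      (cap-≥ (ℕₚ.m≤m+n 4 4) 4≤a) (cap-≥ (ℕₚ.m≤m+n 4 4) 4≤b) (cap-≥ (ℕₚ.m≤m+n 3 5) 3≤o) (cap-sum 4≤a 4≤b 3≤o 15≤))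
    where
    check : ∀ {x y z} {a b o : Fin 9} → toℕ a ≡ x → toℕ b ≡ y → toℕ o ≡ z →
      4 ≤ x → 4 ≤ y → 3 ≤ z → 15 ≤ x + y + z → least-gift x y ≤ gift-bound x y z
    check {a = a} {b} {o} refl refl refl = least-gift-check a b o

  least-gift-cycle : ∀ {a b c} → 4 ≤ a → 4 ≤ b → 4 ≤ c →
    840 ≤ least-gift (cap a) (cap b) + least-gift (cap b) (cap c) + least-gift (cap c) (cap a)
  least-gift-cycle {a} {b} {c} 4≤a 4≤b 4≤c =
    check (proj₂ (capped a)) (proj₂ (capped b)) (proj₂ (capped c))
      (cap-≥ (ℕₚ.m≤m+n 4 4) 4≤a) (cap-≥ (ℕₚ.m≤m+n 4 4) 4≤b) (cap-≥ (ℕₚ.m≤m+n 4 4) 4≤c)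
    where
    check : ∀ {x y z} {a b c : Fin 9} → toℕ a ≡ x → toℕ b ≡ y → toℕ c ≡ z →
      4 ≤ x → 4 ≤ y → 4 ≤ z → 840 ≤ least-gift x y + least-gift y z + least-gift z x
    check {a = a} {b} {c} refl refl refl = triangle-check a b c

  ≡ᵇ-true : ∀ {m n} → (m ≡ᵇ n) ≡ true → m ≡ n
  ≡ᵇ-true {m} {n} eq = ℕₚ.≡ᵇ⇒≡ m n (subst T (sym eq) _)

  ≡-≡ᵇ : ∀ {m n} → m ≡ n → (m ≡ᵇ n) ≡ true
  ≡-≡ᵇ {m} {n} eq with m ≡ᵇ n | ℕₚ.≡⇒≡ᵇ m n eq
  ... | true | _ = refl

  bit : Bool → ℕ
  bit true = 1
  bit false = 0

  ∧-true : ∀ {a b} → a ∧ b ≡ true → a ≡ true × b ≡ true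
  ∧-true {true} {true} _ = refl , refl

  -- Two triangles at a vertex are opposite, and then share equally; a single one
  -- gets everything.
  vertex-balance : ∀ s₀ s₁ s₂ s₃ x₀ x₁ x₂ x₃ →
    (s₀ ≡ 3 → x₀ ≡ 0) → (s₁ ≡ 3 → x₁ ≡ 0) → (s₂ ≡ 3 → x₂ ≡ 0) → (s₃ ≡ 3 → x₃ ≡ 0) →
    (s₀ ≡ 3 → s₁ ≢ 3) → (s₁ ≡ 3 → s₂ ≢ 3) → (s₂ ≡ 3 → s₃ ≢ 3) → (s₃ ≡ 3 → s₀ ≢ 3) →
    (if s₀ ≡ᵇ 3 then gift s₂ x₁ x₃ x₂ else 0) +
    (if s₁ ≡ᵇ 3 then gift s₃ x₂ x₀ x₃ else 0) +
    (if s₃ ≡ᵇ 3 then gift s₁ x₀ x₂ x₁ else 0) +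
    (if s₂ ≡ᵇ 3 then gift s₀ x₃ x₁ x₀ else 0)
    ≤ 2 * x₀ + 2 * x₁ + 2 * x₃ + 2 * x₂
  vertex-balance s₀ s₁ s₂ s₃ x₀ x₁ x₂ x₃ z₀ z₁ z₂ z₃ a₀ a₁ a₂ a₃
    with s₀ ≡ᵇ 3 in e₀ | s₁ ≡ᵇ 3 in e₁ | s₂ ≡ᵇ 3 in e₂ | s₃ ≡ᵇ 3 in e₃
  ... | true | true | _ | _ = ⊥-elim (a₀ (≡ᵇ-true e₀) (≡ᵇ-true e₁))
  ... | _ | true | true | _ = ⊥-elim (a₁ (≡ᵇ-true e₁) (≡ᵇ-true e₂))
  ... | _ | _ | true | true = ⊥-elim (a₂ (≡ᵇ-true e₂) (≡ᵇ-true e₃))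
  ... | true | _ | _ | true = ⊥-elim (a₃ (≡ᵇ-true e₃) (≡ᵇ-true e₀))
  ... | false | false | false | false = z≤n
  ... | true | false | false | false rewrite z₀ (≡ᵇ-true e₀) = ℕₚ.≤-reflexive
    (solve 3 (λ x y z → con 2 :* (x :+ y :+ z) :+ con 0 :+ con 0 :+ con 0 :=
                        con 2 :* con 0 :+ con 2 :* x :+ con 2 :* y :+ con 2 :* z) refl x₁ x₃ x₂)
    where open +-*-Solver
  ... | false | true | false | false rewrite z₁ (≡ᵇ-true e₁) = ℕₚ.≤-reflexive
    (solve 3 (λ x y z → con 0 :+ con 2 :* (x :+ y :+ z) :+ con 0 :+ con 0 :=
                        con 2 :* y :+ con 2 :* con 0 :+ con 2 :* z :+ con 2 :* x) refl x₂ x₀ x₃)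
    where open +-*-Solver
  ... | false | false | true | false rewrite z₂ (≡ᵇ-true e₂) = ℕₚ.≤-reflexive
    (solve 3 (λ x y z → con 0 :+ con 0 :+ con 0 :+ con 2 :* (x :+ y :+ z) :=
                        con 2 :* z :+ con 2 :* y :+ con 2 :* x :+ con 2 :* con 0) refl x₃ x₁ x₀)
    where open +-*-Solver
  ... | false | false | false | true rewrite z₃ (≡ᵇ-true e₃) = ℕₚ.≤-reflexive
    (solve 3 (λ x y z → con 0 :+ con 0 :+ con 2 :* (x :+ y :+ z) :+ con 0 :=
                        con 2 :* x :+ con 2 :* z :+ con 2 :* con 0 :+ con 2 :* y) refl x₀ x₂ x₁)
    where open +-*-Solver
  ... | true | false | true | false rewrite z₀ (≡ᵇ-true e₀) | z₂ (≡ᵇ-true e₂) = ℕₚ.≤-reflexive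
    (solve 2 (λ x y → (x :+ y) :+ con 0 :+ con 0 :+ (y :+ x) :=
                        con 2 :* con 0 :+ con 2 :* x :+ con 2 :* y :+ con 2 :* con 0) refl x₁ x₃)
    where open +-*-Solver
  ... | false | true | false | true rewrite z₁ (≡ᵇ-true e₁) | z₃ (≡ᵇ-true e₃) = ℕₚ.≤-reflexive
    (solve 2 (λ x y → con 0 :+ (x :+ y) :+ (y :+ x) :+ con 0 :=
                        con 2 :* y :+ con 2 :* con 0 :+ con 2 :* con 0 :+ con 2 :* x) refl x₂ x₀)
    where open +-*-Solver

  bit⁻¹ : ∀ {b} → 0 < bit b → b ≡ true
  bit⁻¹ {true} _ = refl

  bit-≤1 : ∀ b → bit b ≤ 1
  bit-≤1 true = s≤s z≤n
  bit-≤1 false = z≤n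

  0<m*n⇒0<m : ∀ {m n} → 0 < m * n → 0 < m
  0<m*n⇒0<m {suc m} _ = s≤s z≤n

  0<m*n⇒0<n : ∀ {m n} → 0 < m * n → 0 < n
  0<m*n⇒0<n {m} {n} p = 0<m*n⇒0<m {n} {m} (subst (0 <_) (ℕₚ.*-comm m n) p)

  xor-true : ∀ {a b} → a xor b ≡ true → a ≢ b
  xor-true {a} eq refl with trans (sym eq) (𝔹.xor-same a)
  ... | ()

  not-xor-true : ∀ {a b} → not (a xor b) ≡ true → a ≡ b
  not-xor-true {true} {true} _ = refl
  not-xor-true {false} {false} _ = refl

  guard-≤ : ∀ {s x} → (s ≢ 4 → x ≡ 0) → (if s ≡ᵇ 4 then 0 else 1) ≤ 1 ∸ x
  guard-≤ {s} vanishes with s ℕ.≟ 4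
  ... | yes refl = z≤n
  ... | no s≢4 rewrite vanishes s≢4 with s ≡ᵇ 4
  ... | true = z≤n
  ... | false = ℕₚ.≤-refl

  opposite-≤ : ∀ k s {a x} → (s ≡ true → x ≡ 0) → (a ≢ 4 → x ≡ 0) →
    (if s then weight k 1 1 else weight k 0 (if a ≡ᵇ 4 then 0 else 1)) ≤ weight k (bit s) (1 ∸ x)
  opposite-≤ k true vanishes _ rewrite vanishes refl = ℕₚ.≤-refl
  opposite-≤ k false _ vanishes = weight-mono k z≤n (guard-≤ vanishes)

  zero-or-positive : ∀ m → m ≡ 0 ⊎ 0 < m
  zero-or-positive zero = inj₁ refl
  zero-or-positive (suc _) = inj₂ (s≤s z≤n)

  triangle-surplus : ∀ {s x r} → s ≡ 3 → x ≡ 0 → 840 ≤ r → 2 * x + 3360 ≤ 840 * s + r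
  triangle-surplus refl refl 840≤r = ℕₚ.+-monoʳ-≤ 2520 840≤r

  -- Sums over corners, faces and vertices

  module Discharging {n} (arrangement : OrientedArrangement n) (5≤n : 5 ≤ n) where
    open OrientedArrangement arrangement
    open Faces arrangement 5≤n

    CornerFunction : Set
    CornerFunction = Vec Bool n → Fin n → Fin n → ℕ

    ∮ : Vec Bool n → (Fin n → Fin n → ℕ) → ℕ
    ∮ σ F = ∑∑ (λ i j → corners σ i j * F i j)

    ∮-mono : ∀ {σ F G} → (∀ {i j} → Corner σ i j → F i j ≤ G i j) → ∮ σ F ≤ ∮ σ G
    ∮-mono {σ} {F} {G} F≤G = ∑∑-mono pointwise
      where
      pointwise : ∀ i j → corners σ i j * F i j ≤ corners σ i j * G i j
      pointwise i j with corners σ i j in eq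
      ... | zero = z≤n
      ... | suc m = ℕₚ.*-monoʳ-≤ (suc m) (F≤G (Corner-corners (subst (0 <_) (sym eq) (s≤s z≤n))))

    ∮-cong : ∀ {σ F G} → (∀ {i j} → Corner σ i j → F i j ≡ G i j) → ∮ σ F ≡ ∮ σ G
    ∮-cong F≡G = ℕₚ.≤-antisym (∮-mono (ℕₚ.≤-reflexive ∘ F≡G)) (∮-mono (ℕₚ.≤-reflexive ∘ sym ∘ F≡G))

    ∮-distrib-+ : ∀ σ F G → ∮ σ (λ i j → F i j + G i j) ≡ ∮ σ F + ∮ σ G
    ∮-distrib-+ σ F G = trans (∑∑-cong (λ i j → ℕₚ.*-distribˡ-+ (corners σ i j) (F i j) (G i j)))
      (∑∑-distrib-+ (λ i j → corners σ i j * F i j) (λ i j → corners σ i j * G i j))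

    ∮-* : ∀ σ x F → ∮ σ (λ i j → x * F i j) ≡ x * ∮ σ F
    ∮-* σ x F = trans
      (∑∑-cong (λ i j → solve 3 (λ c x f → c :* (x :* f) := x :* (c :* f)) refl (corners σ i j) x (F i j)))
      (sym (*-distribˡ-∑∑ x (λ i j → corners σ i j * F i j)))
      where open +-*-Solver

    ∮-1 : ∀ σ → ∮ σ (λ _ _ → 1) ≡ size σ
    ∮-1 σ = ∑∑-cong (λ i j → ℕₚ.*-identityʳ (corners σ i j))

    ∮-const : ∀ σ x → ∮ σ (λ _ _ → x) ≡ x * size σ
    ∮-const σ x = begin
      ∮ σ (λ _ _ → x)      ≡⟨ ∮-cong (λ _ → sym (ℕₚ.*-identityʳ x)) ⟩
      ∮ σ (λ _ _ → x * 1)  ≡⟨ ∮-* σ x (λ _ _ → 1) ⟩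
      x * ∮ σ (λ _ _ → 1)  ≡⟨ cong (x *_) (∮-1 σ) ⟩
      x * size σ           ∎
      where open ≡-Reasoning

    total : CornerFunction → ℕ
    total F = ∑∑ (λ i j → ∑ᵗ (λ σ → corners σ i j * F σ i j))

    total-faces : ∀ F → total F ≡ ∑ᵗ (λ σ → ∮ σ (F σ))
    total-faces F = trans
      (sum-cong-≗ (λ i → ∑-∑ᵗ-comm (λ j σ → corners σ i j * F σ i j)))
      (∑-∑ᵗ-comm (λ i σ → ∑ (λ j → corners σ i j * F σ i j)))

    total-mono : ∀ {F G : CornerFunction} → (∀ {σ i j} → Corner σ i j → F σ i j ≤ G σ i j) → total F ≤ total G
    total-mono {F} {G} F≤G = subst₂ _≤_ (sym (total-faces F)) (sym (total-faces G))
      (∑ᵗ-mono {n} (λ σ → ∮-mono {σ} F≤G))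

    total-cong : ∀ {F G : CornerFunction} → (∀ {σ i j} → Corner σ i j → F σ i j ≡ G σ i j) → total F ≡ total G
    total-cong F≡G = ℕₚ.≤-antisym (total-mono (ℕₚ.≤-reflexive ∘ F≡G)) (total-mono (ℕₚ.≤-reflexive ∘ sym ∘ F≡G))

    total-distrib-+ : ∀ F G → total (λ σ i j → F σ i j + G σ i j) ≡ total F + total G
    total-distrib-+ F G = begin
      total (λ σ i j → F σ i j + G σ i j)               ≡⟨ total-faces _ ⟩
      ∑ᵗ (λ σ → ∮ σ (λ i j → F σ i j + G σ i j))        ≡⟨ ∑ᵗ-cong (λ σ → ∮-distrib-+ σ (F σ) (G σ)) ⟩
      ∑ᵗ (λ σ → ∮ σ (F σ) + ∮ σ (G σ))                  ≡⟨ ∑ᵗ-distrib-+ (λ σ → ∮ σ (F σ)) (λ σ → ∮ σ (G σ)) ⟩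
      ∑ᵗ (λ σ → ∮ σ (F σ)) + ∑ᵗ (λ σ → ∮ σ (G σ))       ≡⟨ cong₂ _+_ (total-faces F) (total-faces G) ⟨
      total F + total G                                 ∎
      where open ≡-Reasoning

    -- Crossing circle `i` is a bijection on corners, from (σ, i, j) to (flip i σ, j, i), so both
    -- sums run over the same terms.
    total-across-in : ∀ F → total (λ σ i j → F (flip i σ) j i) ≡ total F
    total-across-in F = trans (∑∑-cong (λ i j → trans
        (∑ᵗ-cong (λ σ → cong (_* F (flip i σ) j i) (sym (corners-flip σ i j))))
        (∑ᵗ-flip i (λ σ → corners σ j i * F σ j i))))
      (∑-comm (λ i j → ∑ᵗ (λ σ → corners σ j i * F σ j i)))

    total-across-out : ∀ F → total (λ σ i j → F (flip j σ) j i) ≡ total F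
    total-across-out F = trans (sym (total-across-in (λ σ i j → F (flip j σ) j i)))
      (total-cong (λ {σ} {i} {j} _ → cong (λ τ → F τ i j) (flip-involutive i σ)))

    -- The four corners at the vertex of a given corner. Each of them can serve as the given one,
    -- whence the factor 4 in `total-around`.
    around : CornerFunction → CornerFunction
    around F σ i j = F σ i j + F (flip i σ) j i + F (flip j σ) j i + F (flip i (flip j σ)) i j

    total-around : ∀ F → total (around F) ≡ 4 * total F
    total-around F = begin
      total (around F)
        ≡⟨ total-distrib-+ (λ σ i j → F σ i j + F (flip i σ) j i + F (flip j σ) j i) F₃ ⟩
      total (λ σ i j → F σ i j + F (flip i σ) j i + F (flip j σ) j i) + total F₃
        ≡⟨ cong (_+ total F₃) (total-distrib-+ (λ σ i j → F σ i j + F (flip i σ) j i) F₂) ⟩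
      total (λ σ i j → F σ i j + F (flip i σ) j i) + total F₂ + total F₃
        ≡⟨ cong (λ x → x + total F₂ + total F₃) (total-distrib-+ F F₁) ⟩
      total F + total F₁ + total F₂ + total F₃
        ≡⟨ cong₂ _+_ (cong₂ _+_ (cong (total F +_) (total-across-in F)) (total-across-out F))
                     (trans (total-across-out F₂) (total-across-out F)) ⟩
      total F + total F + total F + total F
        ≡⟨ solve 1 (λ x → x :+ x :+ x :+ x := con 4 :* x) refl (total F) ⟩
      4 * total F  ∎
      where
      open ≡-Reasoning
      open +-*-Solver
      F₁ F₂ F₃ : CornerFunction
      F₁ σ i j = F (flip i σ) j i
      F₂ σ i j = F (flip j σ) j i
      F₃ σ i j = F (flip i (flip j σ)) i j

    -- What faces give and what triangles receive

    special : Vec Bool n → Fin n → Fin n → Bool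
    special σ i j =
      (size (flip i σ) ≡ᵇ 4) ∧ (size (flip j σ) ≡ᵇ 4) ∧ (size (flip i (flip j σ)) ≡ᵇ 3)

    -- The number (0 or 1) of special corners right after the edge on circle j.
    ahead : Vec Bool n → Fin n → ℕ
    ahead σ j = ∑ (λ k → corners σ j k * bit (special σ j k))

    -- For a heptagon this comes to 210 at a special corner, 150 at the corner just before one, and
    -- 180 elsewhere.
    share : CornerFunction
    share σ i j = weight (size σ) (bit (special σ i j)) (1 ∸ ahead σ j)

    received : CornerFunction
    received σ i j = if size σ ≡ᵇ 3
      then gift (size (flip i (flip j σ))) (share (flip i σ) j i) (share (flip j σ) j i) (share (flip i (flip j σ)) i j)
      else 0

    share-triangle : ∀ σ i j → size σ ≡ 3 → share σ i j ≡ 0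
    share-triangle σ i j eq rewrite eq = refl

    -- The faces around a vertex arise as flips of flips, which simplify only by proved equations;
    -- stating the value up to such equations lets all four corners share the same names.
    received-across : ∀ {σ λ′ ρ ω} i j → flip i σ ≡ λ′ → flip j σ ≡ ρ → flip i (flip j σ) ≡ ω →
      received σ i j ≡ (if size σ ≡ᵇ 3
        then gift (size ω) (share λ′ j i) (share ρ j i) (share ω i j) else 0)
    received-across i j refl refl refl = refl

    received-≤-share : ∀ {σ i j} → Corner σ i j →
      around received σ i j ≤ around (λ σ i j → 2 * share σ i j) σ i j
    received-≤-share {σ} {i} {j} c = begin
      around received σ i j
        ≡⟨ cong₂ _+_ (cong₂ _+_ (cong (received σ i j +_)
            (received-across j i (flip-comm j i σ) (flip-involutive i σ) (trans (cong (flip j) (flip-involutive i σ)) refl)))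
            (received-across j i (flip-involutive j σ) refl
              (trans (flip-comm j i (flip j σ)) (cong (flip i) (flip-involutive j σ)))))
            (received-across i j (flip-involutive i (flip j σ)) ω-out (trans (cong (flip i) ω-out) (flip-involutive i σ))) ⟩
      _
        -- The faces are passed in cyclic order around the vertex, so that consecutive ones are
        -- adjacent, while `around` lists the opposite face last.
        ≤⟨ vertex-balance (size σ) (size (flip i σ)) (size ω) (size (flip j σ))
             (share σ i j) (share (flip i σ) j i) (share ω i j) (share (flip j σ) j i)
             (share-triangle σ i j) (share-triangle (flip i σ) j i) (share-triangle ω i j) (share-triangle (flip j σ) j i)
             (no-triangle-across-in c)
             (λ p → subst (λ τ → size τ ≢ 3) (flip-comm j i σ) (no-triangle-across-in (flip-in c) p))
             (λ p → subst (λ τ → size τ ≢ 3) (flip-involutive i (flip j σ)) (no-triangle-across-in (flip-both c) p))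
             (λ p → subst (λ τ → size τ ≢ 3) (flip-involutive j σ) (no-triangle-across-in (flip-out c) p)) ⟩
      around (λ σ i j → 2 * share σ i j) σ i j  ∎
      where
      open ℕₚ.≤-Reasoning
      ω : Vec Bool n
      ω = flip i (flip j σ)
      ω-out : flip j ω ≡ flip i σ
      ω-out = trans (flip-comm j i (flip j σ)) (cong (flip i) (flip-involutive j σ))

    ahead-≤1 : ∀ σ j → ahead σ j ≤ 1
    ahead-≤1 σ j = ∑-≤1 _ (λ k → ℕₚ.*-mono-≤ (corners-≤1 σ j k) (bit-≤1 (special σ j k)))
      (λ k l p q → next-unique {σ} {j}
        (Corner-corners (0<m*n⇒0<m {corners σ j k} p)) (Corner-corners (0<m*n⇒0<m {corners σ j l} q)))

    ahead-special : ∀ {σ j} → 0 < ahead σ j → ∃ λ k → Corner σ j k × special σ j k ≡ true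
    ahead-special {σ} {j} p with nonzero-∑ (λ k → corners σ j k * bit (special σ j k)) p
    ... | k , q = k , Corner-corners (0<m*n⇒0<m q) , bit⁻¹ (0<m*n⇒0<n {corners σ j k} q)

    ahead-vanishes : ∀ {σ j} → (∀ {k} → Corner σ j k → special σ j k ≢ true) → ahead σ j ≡ 0
    ahead-vanishes {σ} {j} none = case zero-or-positive (ahead σ j) of λ
      { (inj₁ ≡0) → ≡0
      ; (inj₂ 0<) → let k , jk , sp = ahead-special {σ} {j} 0< in ⊥-elim (none jk sp)
      }

    ahead-no-quadrilateral : ∀ {σ j} → size (flip j σ) ≢ 4 → ahead σ j ≡ 0
    ahead-no-quadrilateral ≢4 = ahead-vanishes (λ _ sp → ≢4 (≡ᵇ-true (proj₁ (∧-true sp))))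

    -- Both corners border on the quadrilateral across `j`. The triangles that they face lie across
    -- its sides on `i` and `k`, which are opposite.
    special-not-consecutive : ∀ {σ i j} → Corner σ i j → special σ i j ≡ true → ahead σ j ≡ 0
    special-not-consecutive {σ} {i} {j} ij sp = ahead-vanishes λ {k} jk sp′ →
      no-opposite-triangles (≡ᵇ-true (proj₁ (∧-true sp′))) (flip-in jk) (flip-out ij)
        (trans (cong size (flip-comm k j σ)) (≡ᵇ-true (proj₂ (∧-true (proj₂ (∧-true {size (flip j σ) ≡ᵇ 4} sp′))))))
        (≡ᵇ-true (proj₂ (∧-true (proj₂ (∧-true {size (flip i σ) ≡ᵇ 4} sp)))))

    3≢4 : 3 ≢ 4
    3≢4 ()

    -- A heptagon reduces its share at a corner only if a quadrilateral lies across its next edge.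
    -- For the face across `i` that edge is shared with the triangle itself, so there is no
    -- reduction; for the face across `j` it is shared with the opposite face, and for the opposite
    -- face with the one across `i`. This explains the tests for 4 in `gift-bound` and their
    -- asymmetry.
    received-≥ : ∀ {σ i j} → Corner σ i j → size σ ≡ 3 →
      gift-bound (size (flip i σ)) (size (flip j σ)) (size (flip i (flip j σ))) ≤ received σ i j
    received-≥ {σ} {i} {j} ij σ≡3 rewrite ≡-≡ᵇ σ≡3 = gift-mono (size ω) from-in from-out from-opposite
      where
      a b : ℕ
      a = size (flip i σ)
      b = size (flip j σ)
      ω : Vec Bool n
      ω = flip i (flip j σ)
      from-in : weight a 0 1 ≤ share (flip i σ) j i
      from-in = weight-mono a z≤n (ℕₚ.≤-reflexive (cong (1 ∸_) (sym (ahead-no-quadrilateral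
        (λ eq → 3≢4 (trans (sym σ≡3) (trans (cong size (sym (flip-involutive i σ))) eq)))))))
      from-out : weight b 0 (if size ω ≡ᵇ 4 then 0 else 1) ≤ share (flip j σ) j i
      from-out = weight-mono b z≤n (guard-≤ ahead-no-quadrilateral)
      in-ω : flip i ω ≡ flip j σ
      in-ω = flip-involutive i (flip j σ)
      out-ω : flip j ω ≡ flip i σ
      out-ω = trans (flip-comm j i (flip j σ)) (cong (flip i) (flip-involutive j σ))
      both-ω : flip i (flip j ω) ≡ σ
      both-ω = trans (cong (flip i) out-ω) (flip-involutive i σ)
      special-ω : special ω i j ≡ (b ≡ᵇ 4) ∧ (a ≡ᵇ 4)
      special-ω = trans (cong₂ _∧_ (cong (λ τ → size τ ≡ᵇ 4) in-ω)
        (cong₂ _∧_ (cong (λ τ → size τ ≡ᵇ 4) out-ω) (trans (cong (λ τ → size τ ≡ᵇ 3) both-ω) (≡-≡ᵇ σ≡3))))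
        (cong ((b ≡ᵇ 4) ∧_) (𝔹.∧-identityʳ (a ≡ᵇ 4)))
      from-opposite : (if (b ≡ᵇ 4) ∧ (a ≡ᵇ 4) then weight (size ω) 1 1
                       else weight (size ω) 0 (if a ≡ᵇ 4 then 0 else 1)) ≤ share ω i j
      from-opposite = subst (λ c → (if (b ≡ᵇ 4) ∧ (a ≡ᵇ 4) then weight (size ω) 1 1
                                     else weight (size ω) 0 (if a ≡ᵇ 4 then 0 else 1))
                                   ≤ weight (size ω) (bit c) (1 ∸ ahead ω j))
        (sym special-ω)
        (opposite-≤ (size ω) ((b ≡ᵇ 4) ∧ (a ≡ᵇ 4))
          (λ sp → special-not-consecutive (flip-both ij) (trans special-ω sp))
          (λ a≢4 → ahead-no-quadrilateral (a≢4 ∘ trans (cong size (sym out-ω)))))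

    -- Here 18 = 6 + 12, the supposed lower bound for C(v) plus the corners lost when the four faces
    -- merge.
    Crowded : Set
    Crowded = ∀ {σ i j} → Corner σ i j → 18 ≤ around (λ σ _ _ → size σ) σ i j

    triangle-receives : Crowded → ∀ {σ i j} → Corner σ i j → size σ ≡ 3 → 840 ≤ ∮ σ (received σ)
    triangle-receives crowded {σ} {i} {j} ij σ≡3 = begin
      840
        ≤⟨ least-gift-cycle (side ij) (side jk) (side ki) ⟩
      least-gift (cap (size (flip i σ))) (cap (size (flip j σ))) +
      least-gift (cap (size (flip j σ))) (cap (size (flip k σ))) +
      least-gift (cap (size (flip k σ))) (cap (size (flip i σ)))
        ≤⟨ ℕₚ.+-mono-≤ (ℕₚ.+-mono-≤ (corner-receives ij jk) (corner-receives jk ki)) (corner-receives ki ij) ⟩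
      received σ i j + received σ j k + received σ k i
        ≡⟨ solve 3 (λ x y z → x :+ y :+ z := con 1 :* x :+ (con 1 :* y :+ (con 1 :* z :+ con 0))) refl
             (received σ i j) (received σ j k) (received σ k i) ⟩
      1 * received σ i j + (1 * received σ j k + (1 * received σ k i + 0))
        ≡⟨ cong₂ _+_ (cong (_* received σ i j) (corners-Corner ij))
            (cong₂ _+_ (cong (_* received σ j k) (corners-Corner jk))
              (cong (λ c → c * received σ k i + 0) (corners-Corner ki))) ⟨
      corners σ i j * received σ i j + (corners σ j k * received σ j k + (corners σ k i * received σ k i + 0))
        ≤⟨ ∑∑-≥-unique (λ i j → corners σ i j * received σ i j) {(i , j) ∷ (j , k) ∷ (k , i) ∷ []}
            ((proj₁ ij ∷ proj₁ ki ∘ sym ∷ []) ∷ (proj₁ jk ∷ []) ∷ [] ∷ []) ⟩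
      ∮ σ (received σ) ∎
      where
      open ℕₚ.≤-Reasoning
      open +-*-Solver
      k : Fin n
      k = proj₁ (next ij)
      jk : Corner σ j k
      jk = proj₂ (next ij)
      ki : Corner σ k i
      ki = triangle-closes σ≡3 ij jk
      side : ∀ {i j} → Corner σ i j → 4 ≤ size (flip i σ)
      side c = ℕₚ.≤∧≢⇒< (size-≥3 (flip-in c)) (no-triangle-across-in c σ≡3 ∘ sym)
      corner-receives : ∀ {i j k} → Corner σ i j → Corner σ j k →
        least-gift (cap (size (flip i σ))) (cap (size (flip j σ))) ≤ received σ i j
      corner-receives {i} {j} c c′ = ℕₚ.≤-trans
        (least-gift-≤ (side c) (side c′) (size-≥3 (flip-both c))
          -- The triangle accounts for 3 of the 18, which leaves 15 for the other three faces.
          (ℕₚ.+-cancelˡ-≤ 3 _ _ (subst (18 ≤_)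
            (trans (cong (λ s → s + a + b + o) σ≡3)
              (solve 3 (λ a b o → con 3 :+ a :+ b :+ o := con 3 :+ (a :+ b :+ o)) refl a b o))
            (crowded c))))
        (received-≥ c σ≡3)
        where
        a b o : ℕ
        a = size (flip i σ)
        b = size (flip j σ)
        o = size (flip i (flip j σ))

    -- The left side is, by definition, the sum of `ahead` over all circles. A special corner that
    -- leaves circle `j` has a predecessor arriving on `j`, where the right side counts it.
    specials-≤-ahead : ∀ σ → ∮ σ (λ i j → bit (special σ i j)) ≤ ∮ σ (λ _ j → ahead σ j)
    specials-≤-ahead σ = ℕₚ.≤-trans (∑-mono column)
      (ℕₚ.≤-reflexive (sym (∑-comm (λ i j → corners σ i j * ahead σ j))))
      where
      column : ∀ j → ahead σ j ≤ ∑ (λ i → corners σ i j * ahead σ j)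
      column j = case zero-or-positive (ahead σ j) of λ
        { (inj₁ ≡0) → ℕₚ.≤-trans (ℕₚ.≤-reflexive ≡0) z≤n
        ; (inj₂ 0<) → let
              k , jk , _ = ahead-special {σ} {j} 0<
              i , ij = previous jk
            in ℕₚ.≤-trans
              (ℕₚ.≤-reflexive (trans (sym (ℕₚ.*-identityˡ (ahead σ j))) (cong (_* ahead σ j) (sym (corners-Corner ij)))))
              (∑-≥ (λ i → corners σ i j * ahead σ j) i)
        }

    -- What special corners gain is lost at their predecessors. For a heptagon this bounds the total
    -- by 7 · 150 + 30 · 7 = 1260, three units of 420.
    modulation : ∀ σ → ∮ σ (λ i j → bit (special σ i j)) + ∮ σ (λ _ j → 1 ∸ ahead σ j) ≤ size σ
    modulation σ = begin
      ∮ σ (λ i j → bit (special σ i j)) + ∮ σ (λ _ j → 1 ∸ ahead σ j)  ≤⟨ ℕₚ.+-monoˡ-≤ _ (specials-≤-ahead σ) ⟩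
      ∮ σ (λ _ j → ahead σ j) + ∮ σ (λ _ j → 1 ∸ ahead σ j)            ≡⟨ ∮-distrib-+ σ (λ _ j → ahead σ j) (λ _ j → 1 ∸ ahead σ j) ⟨
      ∮ σ (λ _ j → ahead σ j + (1 ∸ ahead σ j))                        ≡⟨ ∮-cong (λ {_} {j} _ → ℕₚ.m+[n∸m]≡n (ahead-≤1 σ j)) ⟩
      ∮ σ (λ _ _ → 1)                                                  ≡⟨ ∮-1 σ ⟩
      size σ                                                           ∎
      where open ℕₚ.≤-Reasoning

    ∮-constant : ∀ σ x {k} → size σ ≡ k → ∮ σ (λ _ _ → x) ≡ x * k
    ∮-constant σ x eq = trans (∮-const σ x) (cong (x *_) eq)

    -- In doubled units a face of size `k` has the charge 840 (k - 4), and 3360 = 840 · 4. Even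
    -- sharing spends it exactly for sizes 4, 5, 6 and 8; beyond 8 the cutoff saves 420 per
    -- additional corner.
    ∮-weight : ∀ σ k F G → ∮ σ F + ∮ σ G ≤ size σ → size σ ≡ k → 4 ≤ k →
      2 * ∮ σ (λ i j → weight k (F i j) (G i j)) + 3360 ≤ 840 * k
    ∮-weight σ 0 F G _ _ ()
    ∮-weight σ 1 F G _ _ (s≤s ())
    ∮-weight σ 2 F G _ _ (s≤s (s≤s ()))
    ∮-weight σ 3 F G _ _ (s≤s (s≤s (s≤s ())))
    ∮-weight σ 4 F G _ eq _ = ℕₚ.≤-reflexive (cong (λ x → 2 * x + 3360) (∮-constant σ 0 eq))
    ∮-weight σ 5 F G _ eq _ = ℕₚ.≤-reflexive (cong (λ x → 2 * x + 3360) (∮-constant σ 84 eq))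
    ∮-weight σ 6 F G _ eq _ = ℕₚ.≤-reflexive (cong (λ x → 2 * x + 3360) (∮-constant σ 140 eq))
    ∮-weight σ 7 F G F+G≤ eq _ = begin
      2 * ∮ σ (λ i j → 150 + 30 * (F i j + G i j)) + 3360
        ≡⟨ cong (λ x → 2 * x + 3360) (trans (∮-distrib-+ σ (λ _ _ → 150) (λ i j → 30 * (F i j + G i j)))
            (cong₂ _+_ (∮-constant σ 150 eq)
              (trans (∮-* σ 30 (λ i j → F i j + G i j)) (cong (30 *_) (∮-distrib-+ σ F G))))) ⟩
      2 * (1050 + 30 * (∮ σ F + ∮ σ G)) + 3360
        ≤⟨ ℕₚ.+-monoˡ-≤ 3360 (ℕₚ.*-monoʳ-≤ 2 (ℕₚ.+-monoʳ-≤ 1050 (ℕₚ.*-monoʳ-≤ 30 (subst (∮ σ F + ∮ σ G ≤_) eq F+G≤)))) ⟩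
      5880 ∎
      where open ℕₚ.≤-Reasoning
    ∮-weight σ (suc (suc (suc (suc (suc (suc (suc (suc m)))))))) F G _ eq _ = begin
      2 * ∮ σ (λ _ _ → 210) + 3360  ≡⟨ cong (λ x → 2 * x + 3360) (∮-constant σ 210 eq) ⟩
      2 * (210 * (8 + m)) + 3360    ≤⟨ ℕₚ.m≤m+n _ (420 * m) ⟩
      2 * (210 * (8 + m)) + 3360 + 420 * m
        ≡⟨ solve 1 (λ m → con 2 :* (con 210 :* (con 8 :+ m)) :+ con 3360 :+ con 420 :* m := con 840 :* (con 8 :+ m)) refl m ⟩
      840 * (8 + m) ∎
      where
      open ℕₚ.≤-Reasoning
      open +-*-Solver

    -- Free of subtraction, this says that the charge 840 (|f| - 4), less what is given and plus
    -- what is received, is nonnegative.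
    face-balance : Crowded → ∀ {σ i j} → Corner σ i j →
      2 * ∮ σ (share σ) + 3360 ≤ 840 * size σ + ∮ σ (received σ)
    face-balance crowded {σ} ij = by-size (size σ ℕ.≟ 3)
      where
      by-size : Dec (size σ ≡ 3) → 2 * ∮ σ (share σ) + 3360 ≤ 840 * size σ + ∮ σ (received σ)
      by-size (yes σ≡3) = triangle-surplus σ≡3
        (trans (∮-cong (λ {i} {j} _ → share-triangle σ i j σ≡3)) (∮-const σ 0)) (triangle-receives crowded ij σ≡3)
      by-size (no σ≢3) = ℕₚ.≤-trans
        (∮-weight σ (size σ) (λ i j → bit (special σ i j)) (λ _ j → 1 ∸ ahead σ j) (modulation σ) refl
          (ℕₚ.≤∧≢⇒< (size-≥3 ij) (σ≢3 ∘ sym)))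
        (ℕₚ.m≤m+n (840 * size σ) (∮ σ (received σ)))

    -- Forward corners and the contradiction

    -- Orient every circle with the face `p` on its left. The boundary of `σ` follows circle `i`
    -- backwards exactly if `σ` and `p` differ at `i`; so at the corners counted here it turns from
    -- backward to forward, and both oriented edges leave the vertex.
    forward : Vec Bool n → CornerFunction
    forward p σ i j = bit ((lookup σ i xor lookup p i) ∧ not (lookup σ j xor lookup p j))

    one-forward : ∀ a b → bit (a ∧ not b) + bit (b ∧ not (not a)) + bit (not b ∧ not a) + bit (not a ∧ not (not b)) ≡ 1
    one-forward true true = refl
    one-forward true false = refl
    one-forward false true = refl
    one-forward false false = refl

    -- Agreement of `σ` with `p` at `i` and at `j` leaves four cases, and each makes a different one
    -- of the four corners forward.
    around-forward : ∀ p {σ i j} → i ≢ j → around (forward p) σ i j ≡ 1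
    around-forward p {σ} {i} {j} i≢j
      rewrite Vecₚ.lookup∘updateAt i {not} σ | Vecₚ.lookup∘updateAt j {not} σ
            | Vecₚ.lookup∘updateAt′ j i {not} (i≢j ∘ sym) σ | Vecₚ.lookup∘updateAt′ i j {not} i≢j σ
            | Vecₚ.lookup∘updateAt i {not} (flip j σ) | Vecₚ.lookup∘updateAt′ j i {not} (i≢j ∘ sym) (flip j σ)
            | Vecₚ.lookup∘updateAt j {not} σ | Vecₚ.lookup∘updateAt′ i j {not} i≢j σ
            | sym (𝔹.not-distribˡ-xor (lookup σ i) (lookup p i))
            | sym (𝔹.not-distribˡ-xor (lookup σ j) (lookup p j)) =
      one-forward (lookup σ i xor lookup p i) (lookup σ j xor lookup p j)

    forward⁻¹ : ∀ p {σ i j} → 0 < forward p σ i j → lookup σ i ≢ lookup p i × lookup σ j ≡ lookup p j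
    forward⁻¹ p f with ∧-true (bit⁻¹ f)
    ... | x , y = xor-true x , not-xor-true y

    ∮-forward-≤1 : ∀ {p a b} → Corner p a b → ∀ σ → ∮ σ (forward p σ) ≤ 1
    ∮-forward-≤1 {p} ab σ with next ab
    ... | c , bc with next bc
    ... | d , cd = ∑∑-≤1 _
      (λ i j → ℕₚ.*-mono-≤ (corners-≤1 σ i j) (bit-≤1 _))
      (λ i j k l f g → let
          i≢ , j≡ = forward⁻¹ p {σ} {i} {j} (0<m*n⇒0<n {corners σ i j} f)
          k≢ , l≡ = forward⁻¹ p {σ} {k} {l} (0<m*n⇒0<n {corners σ k l} g)
        in forward-unique ab bc cd (λ { refl → no-digon ab bc }) (λ { refl → no-digon bc cd })
             (Corner-corners (0<m*n⇒0<m f)) (Corner-corners (0<m*n⇒0<m g)) i≢ j≡ k≢ l≡)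

    ∮-forward-self : ∀ p → ∮ p (forward p p) ≡ 0
    ∮-forward-self p = trans (∮-cong none) (∮-const p 0)
      where
      none : ∀ {i j} → Corner p i j → forward p p i j ≡ 0
      none {i} {j} _ rewrite 𝔹.xor-same (lookup p i) = refl

    -- The constant 3360 of each face balance is assigned to the forward corner of the face. Counted
    -- once per vertex, it cancels against 840 for each of the four corners there. The face `p`
    -- satisfies its balance without having a forward corner, which makes the inequality strict.
    not-crowded : ∀ {p a b} → Corner p a b → ¬ Crowded
    not-crowded {p} ab crowded = ℕₚ.<-irrefl refl (begin-strict
      doubled + 3360 * total (forward p)             ≡⟨ sum-left ⟨
      ∑ᵗ (λ σ → 2 * ∮ σ (share σ) + 3360 * ∮ σ (forward p σ))
                                                     <⟨ ∑ᵗ-mono-< each-face p strict-face ⟩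
      ∑ᵗ (λ σ → 840 * size σ + ∮ σ (received σ))     ≡⟨ sum-right ⟩
      840 * total (λ _ _ _ → 1) + total received     ≤⟨ ℕₚ.+-monoʳ-≤ _ received-≤-doubled ⟩
      840 * total (λ _ _ _ → 1) + doubled            ≡⟨ cong (λ x → 840 * x + doubled) four-forward ⟩
      840 * (4 * total (forward p)) + doubled        ≡⟨ solve 2 (λ f d → con 840 :* (con 4 :* f) :+ d := d :+ con 3360 :* f) refl (total (forward p)) doubled ⟩
      doubled + 3360 * total (forward p)             ∎)
      where
      open ℕₚ.≤-Reasoning
      open +-*-Solver
      doubled : ℕ
      doubled = total (λ σ i j → 2 * share σ i j)
      no-corners : ∀ {σ} F → size σ ≡ 0 → ∮ σ F ≡ 0
      no-corners {σ} F eq = trans (∮-cong none) (∮-const σ 0)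
        where
        none : ∀ {i j} → Corner σ i j → F i j ≡ 0
        none c = ⊥-elim (ℕₚ.<⇒≱ (s≤s (z≤n {2})) (ℕₚ.≤-trans (size-≥3 c) (ℕₚ.≤-reflexive eq)))
      some-corner : ∀ {σ m} → size σ ≡ suc m → ∃ λ i → ∃ λ j → Corner σ i j
      some-corner {σ} eq with nonzero-∑ (λ i → ∑ (corners σ i)) (subst (0 <_) (sym eq) (s≤s z≤n))
      ... | i , 0<row with nonzero-∑ (corners σ i) 0<row
      ... | j , 0<c = i , j , Corner-corners 0<c
      each-face : ∀ σ → 2 * ∮ σ (share σ) + 3360 * ∮ σ (forward p σ) ≤ 840 * size σ + ∮ σ (received σ)
      each-face σ = by-size (size σ) refl
        where
        by-size : ∀ s → size σ ≡ s →
          2 * ∮ σ (share σ) + 3360 * ∮ σ (forward p σ) ≤ 840 * size σ + ∮ σ (received σ)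
        -- A sign vector without corners need not satisfy the balance with 3360, but it has no
        -- forward corner to which this constant would be assigned.
        by-size zero eq = ℕₚ.≤-trans
          (ℕₚ.≤-reflexive (cong₂ (λ x y → 2 * x + 3360 * y) (no-corners {σ} (share σ) eq) (no-corners {σ} (forward p σ) eq)))
          z≤n
        by-size (suc m) eq = begin
          2 * ∮ σ (share σ) + 3360 * ∮ σ (forward p σ) ≤⟨ ℕₚ.+-monoʳ-≤ (2 * ∮ σ (share σ)) (ℕₚ.*-monoʳ-≤ 3360 (∮-forward-≤1 ab σ)) ⟩
          2 * ∮ σ (share σ) + 3360                     ≤⟨ face-balance crowded (proj₂ (proj₂ (some-corner {σ} eq))) ⟩
          840 * size σ + ∮ σ (received σ)              ∎
      strict-face : 2 * ∮ p (share p) + 3360 * ∮ p (forward p p) < 840 * size p + ∮ p (received p)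
      strict-face = begin-strict
        2 * ∮ p (share p) + 3360 * ∮ p (forward p p) ≡⟨ cong (λ x → 2 * ∮ p (share p) + 3360 * x) (∮-forward-self p) ⟩
        2 * ∮ p (share p) + 0                        <⟨ ℕₚ.+-monoʳ-< (2 * ∮ p (share p)) (s≤s z≤n) ⟩
        2 * ∮ p (share p) + 3360                     ≤⟨ face-balance crowded ab ⟩
        840 * size p + ∮ p (received p)              ∎
      sum-left : ∑ᵗ (λ σ → 2 * ∮ σ (share σ) + 3360 * ∮ σ (forward p σ)) ≡ doubled + 3360 * total (forward p)
      sum-left = trans (∑ᵗ-distrib-+ (λ σ → 2 * ∮ σ (share σ)) (λ σ → 3360 * ∮ σ (forward p σ)))
        (cong₂ _+_
          (trans (∑ᵗ-cong (λ σ → sym (∮-* σ 2 (share σ)))) (sym (total-faces (λ σ i j → 2 * share σ i j))))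
          (trans (sym (*-distribˡ-∑ᵗ 3360 (λ σ → ∮ σ (forward p σ)))) (cong (3360 *_) (sym (total-faces (forward p))))))
      sum-right : ∑ᵗ (λ σ → 840 * size σ + ∮ σ (received σ)) ≡ 840 * total (λ _ _ _ → 1) + total received
      sum-right = trans (∑ᵗ-distrib-+ (λ σ → 840 * size σ) (λ σ → ∮ σ (received σ)))
        (cong₂ _+_
          (trans (sym (*-distribˡ-∑ᵗ 840 size))
            (cong (840 *_) (trans (∑ᵗ-cong (λ σ → sym (∮-1 σ))) (sym (total-faces (λ _ _ _ → 1))))))
          (sym (total-faces received)))
      received-≤-doubled : total received ≤ doubled
      received-≤-doubled = ℕₚ.*-cancelˡ-≤ 4 (subst₂ _≤_ (total-around received) (total-around (λ σ i j → 2 * share σ i j))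
        (total-mono {around received} {around (λ σ i j → 2 * share σ i j)} received-≤-share))
      four-forward : total (λ _ _ _ → 1) ≡ 4 * total (forward p)
      four-forward = trans (sym (total-cong {around (forward p)} (λ {σ} {i} {j} c → around-forward p {σ} {i} {j} (proj₁ c)))) (total-around (forward p))

  -- From lists of vertices to sums over corners

  all-true : ∀ {a} {A : Set a} (p : A → Bool) xs → all p xs ≡ true → ∀ {x} → x ∈ xs → p x ≡ true
  all-true p (x ∷ xs) eq (here refl) = proj₁ (∧-true eq)
  all-true p (x ∷ xs) eq (there x∈) = all-true p xs (proj₂ (∧-true {p x} eq)) x∈

  implied : ∀ {a b} → a ≡ true → not a ∨ not b ≡ true → b ≡ false
  implied {true} {false} _ _ = refl

  module _ {A : Set} (P Q : A → Bool) where
    -- This mirrors the nested filters of `zoneComplexity`: `Q` selects the vertices of the smaller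
    -- arrangement and `P` those on the face.
    kept : List A → ℕ
    kept xs = length (filterᵇ P (filterᵇ Q xs))

    kept-++ : ∀ xs ys → kept (xs ++ ys) ≡ kept xs + kept ys
    kept-++ [] ys = refl
    kept-++ (x ∷ xs) ys with Q x
    ... | false = kept-++ xs ys
    ... | true with P x
    ... | false = kept-++ xs ys
    ... | true = cong suc (kept-++ xs ys)

    kept-concatMap : ∀ {n} {B : Set} (f : B → List A) (g : Fin n → B) →
      kept (concatMap f (tabulate g)) ≡ ∑ (λ i → kept (f (g i)))
    kept-concatMap {zero} f g = refl
    kept-concatMap {suc n} f g = trans (kept-++ (f (g Fin.zero)) (concatMap f (tabulate (g ∘ Fin.suc))))
      (cong (kept (f (g Fin.zero)) +_) (kept-concatMap f (g ∘ Fin.suc)))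

    kept-pair : ∀ {x y q g h} → Q x ≡ q → Q y ≡ q →
      (q ≡ true → P x ≡ true → 1 ≤ g) → (q ≡ true → P y ≡ true → 1 ≤ h) →
      kept (x ∷ y ∷ []) ≤ (if q then g + h else 0)
    kept-pair {x} {y} {false} qx qy gx hy rewrite qx | qy = z≤n
    kept-pair {x} {y} {true} qx qy gx hy rewrite qx with P x in px
    ... | true rewrite qy with P y in py
    ... | true = ℕₚ.+-mono-≤ (gx refl refl) (hy refl refl)
    ... | false = ℕₚ.≤-trans (gx refl refl) (ℕₚ.m≤m+n _ _)
    kept-pair {x} {y} {true} qx qy gx hy | false rewrite qy with P y in py
    ... | true = ℕₚ.≤-trans (hy refl refl) (ℕₚ.m≤n+m _ _)
    ... | false = z≤n

  kept-pairs : ∀ {n} (P Q : Fin n × Fin n × Bool → Bool) →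
    kept P Q (concatMap (λ k → concatMap (λ l → (k , l , true) ∷ (k , l , false) ∷ []) (allFin n)) (allFin n)) ≡
    ∑∑ (λ k l → kept P Q ((k , l , true) ∷ (k , l , false) ∷ []))
  kept-pairs P Q = trans
    (kept-concatMap P Q (λ k → concatMap (λ l → (k , l , true) ∷ (k , l , false) ∷ []) (allFin _)) (λ k → k))
    (sum-cong-≗ (λ k → kept-concatMap P Q (λ l → (k , l , true) ∷ (k , l , false) ∷ []) (λ l → l)))

  ∑∑-ordered-≤ : ∀ {n} (G : Fin n → Fin n → ℕ) →
    ∑∑ (λ k l → if toℕ k <ᵇ toℕ l then G k l + G l k else 0) ≤ ∑∑ G
  ∑∑-ordered-≤ G = begin
    ∑∑ (λ k l → if toℕ k <ᵇ toℕ l then G k l + G l k else 0)  ≡⟨ ∑∑-cong split ⟩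
    ∑∑ (λ k l → upper k l + lower l k)                          ≡⟨ ∑∑-distrib-+ upper (λ k l → lower l k) ⟩
    ∑∑ upper + ∑∑ (λ k l → lower l k)                           ≡⟨ cong (∑∑ upper +_) (∑-comm (λ k l → lower l k)) ⟩
    ∑∑ upper + ∑∑ lower                                         ≡⟨ ∑∑-distrib-+ upper lower ⟨
    ∑∑ (λ k l → upper k l + lower k l)                          ≤⟨ ∑∑-mono disjoint ⟩
    ∑∑ G                                                        ∎
    where
    open ℕₚ.≤-Reasoning
    upper lower : Fin _ → Fin _ → ℕ
    upper k l = if toℕ k <ᵇ toℕ l then G k l else 0
    lower k l = if toℕ l <ᵇ toℕ k then G k l else 0
    split : ∀ k l → (if toℕ k <ᵇ toℕ l then G k l + G l k else 0) ≡ upper k l + lower l k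
    split k l with toℕ k <ᵇ toℕ l
    ... | true = refl
    ... | false = refl
    disjoint : ∀ k l → upper k l + lower k l ≤ G k l
    disjoint k l with toℕ k <ᵇ toℕ l in p | toℕ l <ᵇ toℕ k in q
    ... | true | true = ⊥-elim (ℕₚ.<-asym (ℕₚ.<ᵇ⇒< _ _ (subst T (sym p) _)) (ℕₚ.<ᵇ⇒< (toℕ l) (toℕ k) (subst T (sym q) _)))
    ... | true | false = ℕₚ.≤-reflexive (ℕₚ.+-identityʳ _)
    ... | false | true = ℕₚ.≤-refl
    ... | false | false = z≤n

  -- For the signs of two circles this tells which of ± (L k × L l) is the vector product of the
  -- reoriented normals.
  same : Bool → Bool → Bool
  same a b = not (a xor b)

  -- The statement lists two circles once, in increasing order, with a sign for each of their two
  -- common points. Corners instead distinguish antipodal points by the order of the circles; `s`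
  -- translates between the two conventions.
  count-≤ : ∀ {n} (P Q : Fin n × Fin n × Bool → Bool) (r s : Fin n → Fin n → Bool) (G : Fin n → Fin n → ℕ) →
    (∀ k l t → Q (k , l , t) ≡ ((toℕ k <ᵇ toℕ l) ∧ r k l)) →
    (∀ {k l} → k ≢ l → r k l ≡ true → P (k , l , s k l) ≡ true → 1 ≤ G k l) →
    (∀ {k l} → k ≢ l → r k l ≡ true → P (k , l , not (s k l)) ≡ true → 1 ≤ G l k) →
    kept P Q (concatMap (λ k → concatMap (λ l → (k , l , true) ∷ (k , l , false) ∷ []) (allFin n)) (allFin n)) ≤ ∑∑ G
  count-≤ P Q r s G Q≡ at-s at-not-s = ℕₚ.≤-trans (ℕₚ.≤-reflexive (kept-pairs P Q))
    (ℕₚ.≤-trans (∑∑-mono pair) (∑∑-ordered-≤ G))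
    where
    widen : ∀ a b {x} → (if a ∧ b then x else 0) ≤ (if a then x else 0)
    widen true true = ℕₚ.≤-refl
    widen true false = z≤n
    widen false _ = z≤n
    distinct : ∀ {k l b} → ((toℕ k <ᵇ toℕ l) ∧ b) ≡ true → k ≢ l
    distinct {k} q refl = ℕₚ.<-irrefl refl (ℕₚ.<ᵇ⇒< (toℕ k) (toℕ k) (subst T (sym (proj₁ (∧-true q))) _))
    pair : ∀ k l → kept P Q ((k , l , true) ∷ (k , l , false) ∷ []) ≤ (if toℕ k <ᵇ toℕ l then G k l + G l k else 0)
    pair k l with s k l | at-s {k} {l} | at-not-s {k} {l}
    ... | true | f | g = ℕₚ.≤-trans (kept-pair P Q (Q≡ k l true) (Q≡ k l false)
        (λ q → f (distinct q) (proj₂ (∧-true {toℕ k <ᵇ toℕ l} q)))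
        (λ q → g (distinct q) (proj₂ (∧-true {toℕ k <ᵇ toℕ l} q))))
      (widen (toℕ k <ᵇ toℕ l) (r k l))
    ... | false | f | g = ℕₚ.≤-trans (kept-pair P Q (Q≡ k l true) (Q≡ k l false)
        (λ q → g (distinct q) (proj₂ (∧-true {toℕ k <ᵇ toℕ l} q)))
        (λ q → f (distinct q) (proj₂ (∧-true {toℕ k <ᵇ toℕ l} q))))
      (ℕₚ.≤-trans (widen (toℕ k <ᵇ toℕ l) (r k l))
        (ℕₚ.≤-reflexive (cong (λ x → if toℕ k <ᵇ toℕ l then x else 0) (ℕₚ.+-comm (G l k) (G k l)))))

open Combinatorics

-- Great circles form an oriented arrangement

module GreatCircles {c ℓ₁ ℓ₂} (R : OrderedCommutativeRing c ℓ₁ ℓ₂)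
  {n} (L : Fin n → Sphere.Vec3 R) (general : Sphere.GeneralPosition R L) where
  open OrderedRing R
  open Sphere R
  open Vectors R

  normal : Vec Bool n → Fin n → Vec3
  normal σ i = signed (lookup σ i) (L i)

  det-normal : Vec Bool n → Fin n → Fin n → Fin n → Carrier
  det-normal σ i j k = det (normal σ i) (normal σ j) (normal σ k)

  det-normal-nonzero : ∀ σ {i j k} → i ≢ j → j ≢ k → i ≢ k → ¬ (det-normal σ i j k ≈ 0#)
  det-normal-nonzero σ {i} {j} {k} i≢j j≢k i≢k =
    step i (turn (step k (turn (step j (turn (proj₂ general i j k i≢j j≢k i≢k))))))
    where
    step : ∀ i {b d} → ¬ (det (L i) b d ≈ 0#) → ¬ (det (normal σ i) b d ≈ 0#)
    step i = det-signed-nonzero (lookup σ i) (L i) _ _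
    turn : ∀ {a b d} → ¬ (det a b d ≈ 0#) → ¬ (det b d a ≈ 0#)
    turn {a} {b} {d} ≉0 = ≉0 ∘ trans (det-cycle a b d)

  normal-flip : ∀ σ {i j} → i ≢ j → normal (flip j σ) i ≡ normal σ i
  normal-flip σ {i} {j} i≢j = ≡.cong (λ s → signed s (L i)) (Vecₚ.lookup∘updateAt′ i j i≢j σ)

  dot-normal-flip : ∀ σ i w → dot (normal (flip i σ) i) w ≈ - dot (normal σ i) w
  dot-normal-flip σ i w rewrite Vecₚ.lookup∘updateAt i {not} σ = dot-signed-not (lookup σ i) (L i) w

  det-normal-negate : ∀ σ i j k → det-normal (Vec.map not σ) i j k ≈ - det-normal σ i j k
  det-normal-negate σ i j k = begin
    det (normal τ i) (normal τ j) (normal τ k)          ≈⟨ negated i ⟩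
    - det (normal σ i) (normal τ j) (normal τ k)        ≈⟨ -‿cong (det-cycle (normal σ i) (normal τ j) (normal τ k)) ⟩
    - det (normal τ j) (normal τ k) (normal σ i)        ≈⟨ -‿cong (negated j) ⟩
    - - det (normal σ j) (normal τ k) (normal σ i)      ≈⟨ -‿involutive _ ⟩
    det (normal σ j) (normal τ k) (normal σ i)          ≈⟨ det-cycle (normal σ j) (normal τ k) (normal σ i) ⟩
    det (normal τ k) (normal σ i) (normal σ j)          ≈⟨ negated k ⟩
    - det (normal σ k) (normal σ i) (normal σ j)        ≈⟨ -‿cong (det-cycle (normal σ k) (normal σ i) (normal σ j)) ⟩
    - det (normal σ i) (normal σ j) (normal σ k)        ∎
    where
    open SetoidReasoning setoid
    τ : Vec Bool n
    τ = Vec.map not σ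
    negated : ∀ i {b d} → det (normal τ i) b d ≈ - det (normal σ i) b d
    negated i {b} {d} rewrite Vecₚ.lookup-map i not σ = dot-signed-not (lookup σ i) (L i) (cross b d)

  positive : Vec Bool n → Fin n → Fin n → Fin n → Bool
  positive σ i j k = positive? (det-normal σ i j k)

  -- `cramer` is applied to `v`, the vector product of the normals of `i` and `j`, which is
  -- orthogonal to that of `j`. The circles `a`, `b`, `d` all have `v` on their positive side, so
  -- every remaining factor has a known sign. Geometrically, they meet circle `j` in an open half
  -- circle, where their order is linear.
  transitive : ∀ σ i j {a b d} →
    positive σ i j a ≡ true → positive σ i j b ≡ true → positive σ i j d ≡ true →
    positive σ j a b ≡ true → positive σ j b d ≡ true → positive σ j a d ≡ true
  transitive σ i j {a} {b} {d} ija ijb ijd jab jbd = positive?-true (*-cancel-positive (behind ijb)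
    (<-respʳ-≈ (sym identity)
      (+-positive-nonnegative (+-positive (*-pos (positive?⁻¹ jab) (behind ijd)) (*-pos (positive?⁻¹ jbd) (behind ija)))
        (inj₂ vanishing))))
    where
    v : Vec3
    v = cross (normal σ i) (normal σ j)
    behind : ∀ {m} → positive σ i j m ≡ true → 0# < dot v (normal σ m)
    behind {m} ijm = <-respʳ-≈ (trans (sym (det-cycle (normal σ m) (normal σ i) (normal σ j))) (dot-comm (normal σ m) v))
      (positive?⁻¹ ijm)
    identity : det-normal σ j a d * dot v (normal σ b) ≈
      det-normal σ j a b * dot v (normal σ d) + det-normal σ j b d * dot v (normal σ a)
        + - (det-normal σ a b d * dot v (normal σ j))
    identity = cramer (normal σ j) (normal σ a) (normal σ b) (normal σ d) v
    vanishing : - (det-normal σ a b d * dot v (normal σ j)) ≈ 0#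
    vanishing = trans (-‿cong (trans
      (*-congˡ (trans (dot-comm v (normal σ j)) (det-repeat′ (normal σ i) (normal σ j)))) (zeroʳ _))) -0#≈0#

  -- The content of `Corner` before `arrangement` is available. As `arrangement` is opaque,
  -- `corner-intro` and `corner-elim` later pass between the two forms.
  InCorner : Vec Bool n → Fin n → Fin n → Set
  InCorner σ i j = i ≢ j × (∀ m → m ≢ i → m ≢ j → positive σ i j m ≡ true)

  vertex : Vec Bool n → Fin n → Fin n → Vec3
  vertex σ i j = cross (normal σ i) (normal σ j)

  side-positive : ∀ σ {i j m} → InCorner σ i j → m ≢ i → m ≢ j → 0# < dot (normal σ m) (vertex σ i j)
  side-positive σ {i} {j} {m} (_ , left) m≢i m≢j =
    <-respʳ-≈ (sym (det-cycle (normal σ m) (normal σ i) (normal σ j))) (positive?⁻¹ (left m m≢i m≢j))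

  side-nonnegative : ∀ σ {i j} → InCorner σ i j → ∀ m → Nonnegative (dot (normal σ m) (vertex σ i j))
  side-nonnegative σ {i} {j} ij m with m Fin.≟ i | m Fin.≟ j
  ... | yes ≡.refl | _ = inj₂ (det-repeat (normal σ i) (normal σ j))
  ... | no _ | yes ≡.refl = inj₂ (det-repeat′ (normal σ i) (normal σ j))
  ... | no m≢i | no m≢j = inj₁ (side-positive σ ij m≢i m≢j)

  normal-≡ : ∀ σ p {i} → lookup σ i ≡ lookup p i → normal σ i ≡ normal p i
  normal-≡ σ p {i} = ≡.cong (λ s → signed s (L i))

  dot-normal-≢ : ∀ σ p {i} w → lookup σ i ≢ lookup p i → dot (normal σ i) w ≈ - dot (normal p i) w
  dot-normal-≢ σ p {i} w ≢ = trans
    (reflexive (≡.cong (λ s → dot (signed s (L i)) w) (𝔹.¬-not ≢)))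
    (dot-signed-not (lookup p i) (L i) w)

  -- Uniqueness of the forward corner of a face

  module Pole (N : Vec3) (p : Vec Bool n) (inside : ∀ m → 0# < dot (normal p m) N) (σ : Vec Bool n) where
    toward : ∀ {m} → lookup σ m ≡ lookup p m → 0# < dot N (normal σ m)
    toward {m} ≡ = <-respʳ-≈ (trans (reflexive (≡.cong (λ a → dot a N) (≡.sym (normal-≡ σ p ≡)))) (dot-comm (normal σ m) N)) (inside m)

    away : ∀ {m} → lookup σ m ≢ lookup p m → 0# < - dot N (normal σ m)
    away {m} ≢ = <-respʳ-≈ (sym (begin
      - dot N (normal σ m)      ≈⟨ -‿cong (dot-comm N (normal σ m)) ⟩
      - dot (normal σ m) N      ≈⟨ -‿cong (dot-normal-≢ σ p N ≢) ⟩
      - - dot (normal p m) N    ≈⟨ -‿involutive _ ⟩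
      dot (normal p m) N        ∎)) (inside m)
      where open SetoidReasoning setoid

    -- Positive if, seen from `N`, the second vertex lies counterclockwise from the first.
    turn : Fin n → Fin n → Fin n → Fin n → Carrier
    turn i j k l = dot N (cross (vertex σ i j) (vertex σ k l))

    turn-reverse : ∀ i j k l → turn k l i j ≈ - turn i j k l
    turn-reverse i j k l = det-swapʳ N (vertex σ i j) (vertex σ k l)

    turn-expand : ∀ i j k l → turn i j k l ≈
      dot N (normal σ j) * dot (normal σ i) (vertex σ k l) + - dot N (normal σ i) * dot (normal σ j) (vertex σ k l)
    turn-expand i j k l = cross-cross N (normal σ i) (normal σ j) (vertex σ k l)

    module _ {i j k l} (i≢ : lookup σ i ≢ lookup p i) (j≡ : lookup σ j ≡ lookup p j) (kl : InCorner σ k l) where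
      turn-nonnegative : Nonnegative (turn i j k l)
      turn-nonnegative = nonnegative-resp-≈ (sym (turn-expand i j k l)) (+-nonnegative
        (*-nonnegative (toward j≡) (side-nonnegative σ kl i)) (*-nonnegative (away i≢) (side-nonnegative σ kl j)))

      turn-positive : (i ≢ k × i ≢ l) ⊎ (j ≢ k × j ≢ l) → 0# < turn i j k l
      turn-positive (inj₁ (i≢k , i≢l)) = <-respʳ-≈ (sym (turn-expand i j k l)) (+-positive-nonnegative
        (*-pos (toward j≡) (side-positive σ kl i≢k i≢l)) (*-nonnegative (away i≢) (side-nonnegative σ kl j)))
      turn-positive (inj₂ (j≢k , j≢l)) = <-respʳ-≈ (sym (turn-expand i j k l)) (+-nonnegative-positive
        (*-nonnegative (toward j≡) (side-nonnegative σ kl i)) (*-pos (away i≢) (side-positive σ kl j≢k j≢l)))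

    -- Seen from `N`, no vertex of the face lies clockwise from that of a forward corner. Two
    -- forward corners would each have to lie counterclockwise from the other, strictly in one
    -- direction, against the antisymmetry of `turn`.
    unique : ∀ {i j k l} → InCorner σ i j → InCorner σ k l →
      lookup σ i ≢ lookup p i → lookup σ j ≡ lookup p j →
      lookup σ k ≢ lookup p k → lookup σ l ≡ lookup p l → i ≡ k × j ≡ l
    unique {i} {j} {k} {l} ij kl i≢ j≡ k≢ l≡ = conclude
      where
      clash : (i ≢ k × i ≢ l) ⊎ (j ≢ k × j ≢ l) → ⊥
      clash apart = positive⇒¬nonnegative (turn-positive i≢ j≡ kl apart) (turn-reverse i j k l) (turn-nonnegative k≢ l≡ ij)
      i≢l : i ≢ l
      i≢l ≡.refl = i≢ l≡
      j≢k : j ≢ k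
      j≢k ≡.refl = k≢ j≡
      conclude : i ≡ k × j ≡ l
      conclude with i Fin.≟ k | j Fin.≟ l
      ... | yes i≡k | yes j≡l = i≡k , j≡l
      ... | no i≢k | _ = ⊥-elim (clash (inj₁ (i≢k , i≢l)))
      ... | yes _ | no j≢l = ⊥-elim (clash (inj₂ (j≢k , j≢l)))

  -- An interior point of the face as a sum of vertices. Two consecutive vertices lie on a common
  -- circle `b`; the third leaves it.
  pole : Vec Bool n → Fin n → Fin n → Fin n → Fin n → Vec3
  pole p a b d e = (vertex p a b ⊕ vertex p b d) ⊕ vertex p d e

  pole-inside : ∀ p {a b d e} → InCorner p a b → InCorner p b d → InCorner p d e → a ≢ d → b ≢ e →
    ∀ m → 0# < dot (normal p m) (pole p a b d e)
  pole-inside p {a} {b} {d} {e} ab bd de a≢d b≢e m = <-respʳ-≈ (sym (trans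
    (dot-⊕ (normal p m) (vertex p a b ⊕ vertex p b d) (vertex p d e))
    (+-congʳ (dot-⊕ (normal p m) (vertex p a b) (vertex p b d))))) sum-positive
    where
    sum-positive : 0# < dot (normal p m) (vertex p a b) + dot (normal p m) (vertex p b d) + dot (normal p m) (vertex p d e)
    sum-positive with m Fin.≟ a | m Fin.≟ b
    ... | yes ≡.refl | _ = +-positive-nonnegative
      (+-nonnegative-positive (side-nonnegative p ab m) (side-positive p bd (proj₁ ab) a≢d))
      (side-nonnegative p de m)
    ... | no _ | yes ≡.refl = +-nonnegative-positive
      (+-nonnegative (side-nonnegative p ab m) (side-nonnegative p bd m))
      (side-positive p de (proj₁ bd) b≢e)
    ... | no m≢a | no m≢b = +-positive-nonnegative
      (+-positive-nonnegative (side-positive p ab m≢a m≢b) (side-nonnegative p bd m))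
      (side-nonnegative p de m)

  flip-at : ∀ σ {i j k} → i ≢ j → j ≢ k → i ≢ k → positive (flip i σ) i j k ≡ not (positive σ i j k)
  flip-at σ {i} {j} {k} i≢j j≢k i≢k
    rewrite normal-flip σ (i≢j ∘ ≡.sym) | normal-flip σ (i≢k ∘ ≡.sym) =
    positive?-neg (det-normal-nonzero σ i≢j j≢k i≢k) (dot-normal-flip σ i (cross (normal σ j) (normal σ k)))
  flip-away : ∀ σ {i j k m} → i ≢ m → j ≢ m → k ≢ m → positive (flip m σ) i j k ≡ positive σ i j k
  flip-away σ i≢m j≢m k≢m
    rewrite normal-flip σ i≢m | normal-flip σ j≢m | normal-flip σ k≢m = ≡.refl

  opaque
    arrangement : OrientedArrangement n
    arrangement = record
      { positive = positive
      ; cycle = λ σ i j k → positive?-cong (det-cycle (normal σ i) (normal σ j) (normal σ k))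
      ; swap = λ σ {i} {j} {k} i≢j j≢k i≢k → positive?-neg (det-normal-nonzero σ i≢j j≢k i≢k)
          (det-swap (normal σ i) (normal σ j) (normal σ k))
      ; negate = λ σ {i} {j} {k} i≢j j≢k i≢k → positive?-neg (det-normal-nonzero σ i≢j j≢k i≢k)
          (det-normal-negate σ i j k)
      ; flip-at = flip-at
      ; flip-away = flip-away
      ; transitive = transitive
      ; forward-unique = λ {p} {a} {b} {d} {e} ab bd de a≢d b≢e {σ} →
          Pole.unique (pole p a b d e) p (pole-inside p ab bd de a≢d b≢e) σ
      }

    corner-intro : ∀ {σ i j} → InCorner σ i j → OrientedArrangement.Corner arrangement σ i j
    corner-intro c = c

    corner-elim : ∀ {σ i j} → OrientedArrangement.Corner arrangement σ i j → InCorner σ i j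
    corner-elim c = c

-- The zone of a vertex and the four faces around it

module Zones {c ℓ₁ ℓ₂} (R : OrderedCommutativeRing c ℓ₁ ℓ₂)
  {n} (L : Fin n → Sphere.Vec3 R) (general : Sphere.GeneralPosition R L) where
  open OrderedRing R hiding (_+_)
  open import Data.Nat using (_+_)
  open Sphere R
  open Vectors R
  open Signs R
  open GreatCircles R L general
  open OrientedArrangement arrangement using (Corner; corner?; corners; size)

  dot-vertexPoint : ∀ σ k l u →
    dot u (vertexPoint L k l (same (lookup σ k) (lookup σ l))) ≈ dot u (vertex σ k l)
  dot-vertexPoint σ k l u with lookup σ k | lookup σ l
  ... | false | false = refl
  ... | false | true = trans (dot-negʳ u (cross (L k) (L l))) (sym (cross-negʳ u (L k) (L l)))
  ... | true | false = trans (dot-negʳ u (cross (L k) (L l))) (sym (cross-negˡ u (L k) (L l)))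
  ... | true | true = sym (trans (cross-negˡ u (L k) (negV (L l)))
    (trans (-‿cong (cross-negʳ u (L k) (L l))) (-‿involutive _)))

  vertexPoint-not : ∀ k l t u → dot u (vertexPoint L k l (not t)) ≈ - dot u (vertexPoint L k l t)
  vertexPoint-not k l true u = dot-negʳ u (cross (L k) (L l))
  vertexPoint-not k l false u = sym (trans (-‿cong (dot-negʳ u (cross (L k) (L l)))) (-‿involutive _))

  vertexPoint-nonzero : ∀ {m k l} t → m ≢ k → k ≢ l → m ≢ l → ¬ (dot (L m) (vertexPoint L k l t) ≈ 0#)
  vertexPoint-nonzero {m} {k} {l} true m≢k k≢l m≢l = proj₂ general m k l m≢k k≢l m≢l
  vertexPoint-nonzero {m} {k} {l} false m≢k k≢l m≢l ≈0 = proj₂ general m k l m≢k k≢l m≢l (begin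
    det (L m) (L k) (L l)                       ≈⟨ vertexPoint-not k l false (L m) ⟩
    - dot (L m) (vertexPoint L k l false)       ≈⟨ -‿cong ≈0 ⟩
    - 0#                                        ≈⟨ -0#≈0# ⟩
    0#                                          ∎)
    where open SetoidReasoning setoid

  corner-at : ∀ τ {k l} → k ≢ l →
    (∀ m → m ≢ k → m ≢ l → 0# < dot (normal τ m) (vertexPoint L k l (same (lookup τ k) (lookup τ l)))) → Corner τ k l
  corner-at τ {k} {l} k≢l inside = corner-intro {τ} {k} {l} (k≢l , λ m m≢k m≢l → positive?-true
    (<-respʳ-≈ (trans (dot-vertexPoint τ k l (normal τ m)) (det-cycle (normal τ m) (normal τ k) (normal τ l))) (inside m m≢k m≢l)))

  corner-at-antipode : ∀ τ {k l} → k ≢ l →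
    (∀ m → m ≢ k → m ≢ l → 0# < dot (normal τ m) (vertexPoint L k l (not (same (lookup τ k) (lookup τ l))))) → Corner τ l k
  corner-at-antipode τ {k} {l} k≢l inside = corner-intro {τ} {l} {k} (k≢l ∘ ≡.sym , λ m m≢l m≢k → positive?-true (<-respʳ-≈ (begin
    dot (normal τ m) (vertexPoint L k l (not (same (lookup τ k) (lookup τ l))))
      ≈⟨ vertexPoint-not k l (same (lookup τ k) (lookup τ l)) (normal τ m) ⟩
    - dot (normal τ m) (vertexPoint L k l (same (lookup τ k) (lookup τ l)))
      ≈⟨ -‿cong (dot-vertexPoint τ k l (normal τ m)) ⟩
    - det (normal τ m) (normal τ k) (normal τ l)  ≈⟨ det-swapʳ (normal τ m) (normal τ k) (normal τ l) ⟨
    det (normal τ m) (normal τ l) (normal τ k)    ≈⟨ det-cycle (normal τ m) (normal τ l) (normal τ k) ⟩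
    det (normal τ l) (normal τ k) (normal τ m)    ∎) (inside m m≢k m≢l)))
    where open SetoidReasoning setoid

  avoiding : Fin n → Fin n → Vec Bool n → Fin n → Fin n → ℕ
  avoiding i j τ k l = if notIn i j k ∧ notIn i j l then corners τ k l else 0

  notIn-true : ∀ {i j m : Fin n} → notIn i j m ≡ true → m ≢ i × m ≢ j
  notIn-true {i} {j} {m} eq with m ≟ i | m ≟ j
  ... | no m≢i | no m≢j = m≢i , m≢j
  notIn-true () | yes _ | _
  notIn-true () | no _ | yes _

  notIn-intro : ∀ {i j m : Fin n} → m ≢ i → m ≢ j → notIn i j m ≡ true
  notIn-intro {i} {j} {m} m≢i m≢j rewrite dec-false (m ≟ i) m≢i | dec-false (m ≟ j) m≢j = ≡.refl

  -- One of the four faces at the vertex of i and j: sums over them dominate.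
  _among_,_,_ : Vec Bool n → Fin n → Fin n → Vec Bool n → Set
  τ among i , j , σ = ∀ (F : Vec Bool n → ℕ) → F τ ≤ F σ + F (flip i σ) + F (flip j σ) + F (flip i (flip j σ))

  module _ {σ i j} (ij : Corner σ i j) where
    private
      v : Vec3
      v = vertexPoint L i j (same (lookup σ i) (lookup σ j))

    module _ {k l t} (k≢l : k ≢ l) (k∉ : notIn i j k ≡ true) (l∉ : notIn i j l ≡ true)
             (inFace : inFaceClosure L i j v (vertexPoint L k l t) ≡ true) where
      private
        w : Vec3
        w = vertexPoint L k l t
        k≢i = proj₁ (notIn-true {i} {j} {k} k∉)
        k≢j = proj₂ (notIn-true {i} {j} {k} k∉)
        l≢i = proj₁ (notIn-true {i} {j} {l} l∉)
        l≢j = proj₂ (notIn-true {i} {j} {l} l∉)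

      -- Membership in the closed face becomes strict at every circle that does not pass through
      -- `w`, by general position.
      beyond : ∀ {m} → m ≢ i → m ≢ j → m ≢ k → m ≢ l → 0# < dot (normal σ m) w
      beyond {m} m≢i m≢j m≢k m≢l = same-side (lookup σ m)
        (<-respʳ-≈ (sym (dot-vertexPoint σ i j (normal σ m))) (side-positive σ (corner-elim {σ} {i} {j} ij) m≢i m≢j))
        (vertexPoint-nonzero t m≢k k≢l m≢l)
        (implied (notIn-intro {i} {j} {m} m≢i m≢j) (all-true _ (allFin n) inFace (∈-allFin m)))

      side : ∀ {m} → m ≢ k → m ≢ l → 0# < dot (normal σ m) w ⊎ 0# < dot (normal (flip m σ) m) w
      side {m} m≢k m≢l with compare (dot (normal σ m) w) 0#
      ... | tri> _ _ 0<w = inj₁ 0<w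
      ... | tri< w<0 _ _ = inj₂ (<-respʳ-≈ (sym (dot-normal-flip σ m w)) (negative⇒-positive w<0))
      ... | tri≈ _ w≈0 _ = ⊥-elim (nonzero (lookup σ m) w≈0)
        where
        nonzero : ∀ s → ¬ (dot (signed s (L m)) w ≈ 0#)
        nonzero false = vertexPoint-nonzero t m≢k k≢l m≢l
        nonzero true ≈0 = vertexPoint-nonzero t m≢k k≢l m≢l
          (trans (sym (-‿involutive _)) (trans (-‿cong (trans (sym (dot-negˡ (L m) w)) ≈0)) -0#≈0#))

  meeting : Vec Bool n → Fin n → Fin n → Fin n → Fin n → ℕ
  meeting σ i j k l = avoiding i j σ k l + avoiding i j (flip i σ) k l
    + avoiding i j (flip j σ) k l + avoiding i j (flip i (flip j σ)) k l

  avoiding-Corner : ∀ {i j τ k l} → notIn i j k ≡ true → notIn i j l ≡ true → Corner τ k l → 1 ≤ avoiding i j τ k l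
  avoiding-Corner {τ = τ} {k} {l} k∉ l∉ c rewrite k∉ | l∉ = ℕₚ.≤-reflexive (≡.sym (indicator-yes (corner? τ k l) c))

  module _ {σ i j} (ij : Corner σ i j) where
    private
      v : Vec3
      v = vertexPoint L i j (same (lookup σ i) (lookup σ j))
      i≢j : i ≢ j
      i≢j = proj₁ ij

    module _ {k l t} (k≢l : k ≢ l) (k∉ : notIn i j k ≡ true) (l∉ : notIn i j l ≡ true)
             (inFace : inFaceClosure L i j v (vertexPoint L k l t) ≡ true) where
      private
        w : Vec3
        w = vertexPoint L k l t
        k≢i = proj₁ (notIn-true {i} {j} {k} k∉)
        k≢j = proj₂ (notIn-true {i} {j} {k} k∉)
        l≢i = proj₁ (notIn-true {i} {j} {l} l∉)
        l≢j = proj₂ (notIn-true {i} {j} {l} l∉)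

        -- The one of the four faces at `v` that has `w` as a corner: `w` itself decides the signs
        -- at `i` and `j`, and `σ` all the others.
        Face : Set _
        Face = ∃ λ τ → τ among i , j , σ × (∀ m → m ≢ i → m ≢ j → lookup τ m ≡ lookup σ m) ×
          (∀ m → m ≢ k → m ≢ l → 0# < dot (normal τ m) w)

        assemble : ∀ τ → τ among i , j , σ → (∀ m → m ≢ i → m ≢ j → lookup τ m ≡ lookup σ m) →
          0# < dot (normal τ i) w → 0# < dot (normal τ j) w → Face
        assemble τ τ∈ agrees at-i at-j = τ , τ∈ , agrees , inside
          where
          inside : ∀ m → m ≢ k → m ≢ l → 0# < dot (normal τ m) w
          inside m m≢k m≢l with m ≟ i | m ≟ j
          ... | yes ≡.refl | _ = at-i
          ... | no _ | yes ≡.refl = at-j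
          ... | no m≢i | no m≢j = subst (λ a → 0# < dot a w) (≡.sym (normal-≡ τ σ (agrees m m≢i m≢j)))
            (beyond {σ} ij {t = t} k≢l k∉ l∉ inFace m≢i m≢j m≢k m≢l)

        flip-agrees : ∀ (τ : Vec Bool n) m i → m ≢ i → lookup (flip i τ) m ≡ lookup τ m
        flip-agrees τ m i m≢i = Vecₚ.lookup∘updateAt′ m i m≢i τ

        face : Face
        face with side {σ} ij {t = t} k≢l k∉ l∉ inFace (k≢i ∘ ≡.sym) (l≢i ∘ ≡.sym)
                | side {σ} ij {t = t} k≢l k∉ l∉ inFace (k≢j ∘ ≡.sym) (l≢j ∘ ≡.sym)
        ... | inj₁ at-i | inj₁ at-j = assemble σ
          (λ F → ℕₚ.≤-trans (ℕₚ.m≤m+n _ _) (ℕₚ.≤-trans (ℕₚ.m≤m+n _ _) (ℕₚ.m≤m+n _ _)))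
          (λ _ _ _ → ≡.refl) at-i at-j
        ... | inj₂ at-i | inj₁ at-j = assemble (flip i σ)
          (λ F → ℕₚ.≤-trans (ℕₚ.m≤n+m _ (F σ)) (ℕₚ.≤-trans (ℕₚ.m≤m+n _ _) (ℕₚ.m≤m+n _ _)))
          (λ m m≢i _ → flip-agrees σ m i m≢i) at-i
          (subst (λ a → 0# < dot a w) (≡.sym (normal-flip σ (i≢j ∘ ≡.sym))) at-j)
        ... | inj₁ at-i | inj₂ at-j = assemble (flip j σ)
          (λ F → ℕₚ.≤-trans (ℕₚ.m≤n+m _ (F σ + F (flip i σ))) (ℕₚ.m≤m+n _ _))
          (λ m _ m≢j → flip-agrees σ m j m≢j)
          (subst (λ a → 0# < dot a w) (≡.sym (normal-flip σ i≢j)) at-i) at-j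
        ... | inj₂ at-i | inj₂ at-j = assemble (flip i (flip j σ))
          (λ F → ℕₚ.m≤n+m _ (F σ + F (flip i σ) + F (flip j σ)))
          (λ m m≢i m≢j → ≡.trans (flip-agrees (flip j σ) m i m≢i) (flip-agrees σ m j m≢j))
          (subst (λ a → 0# < dot a w) (normal-≡ (flip i σ) (flip i (flip j σ))
            (≡.trans (Vecₚ.lookup∘updateAt i σ) (≡.sym (≡.trans (Vecₚ.lookup∘updateAt i (flip j σ))
              (cong not (flip-agrees σ i j i≢j)))))) at-i)
          (subst (λ a → 0# < dot a w) (≡.sym (normal-flip (flip j σ) (i≢j ∘ ≡.sym))) at-j)

      counted : t ≡ same (lookup σ k) (lookup σ l) → 1 ≤ meeting σ i j k l
      counted eq with face
      ... | τ , τ∈ , agrees , inside = ℕₚ.≤-trans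
        (avoiding-Corner {i} {j} {τ} k∉ l∉ (corner-at τ k≢l (subst (λ t → ∀ m → m ≢ k → m ≢ l → 0# < dot (normal τ m) (vertexPoint L k l t))
          (≡.trans eq (cong₂ same (≡.sym (agrees k k≢i k≢j)) (≡.sym (agrees l l≢i l≢j)))) inside)))
        (τ∈ (λ τ → avoiding i j τ k l))

      counted-antipode : t ≡ not (same (lookup σ k) (lookup σ l)) → 1 ≤ meeting σ i j l k
      counted-antipode eq with face
      ... | τ , τ∈ , agrees , inside = ℕₚ.≤-trans
        (avoiding-Corner {i} {j} {τ} l∉ k∉ (corner-at-antipode τ k≢l (subst (λ t → ∀ m → m ≢ k → m ≢ l → 0# < dot (normal τ m) (vertexPoint L k l t))
          (≡.trans eq (cong not (cong₂ same (≡.sym (agrees k k≢i k≢j)) (≡.sym (agrees l l≢i l≢j))))) inside)))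
        (τ∈ (λ τ → avoiding i j τ l k))

    -- Deleting `i` and `j` glues the four faces at `v`, so every vertex of the zone is a corner of
    -- one of them and involves neither circle. This direction serves because C(v) is assumed to be
    -- large.
    zone-≤ : zoneComplexity L i j (same (lookup σ i) (lookup σ j)) ≤ ∑∑ (meeting σ i j)
    zone-≤ = count-≤ _ _ (λ k l → notIn i j k ∧ notIn i j l) (λ k l → same (lookup σ k) (lookup σ l)) (meeting σ i j)
      (λ _ _ _ → ≡.refl)
      (λ {k} {l} k≢l q p → counted {k} {l} {same (lookup σ k) (lookup σ l)} k≢l
        (proj₁ (∧-true q)) (proj₂ (∧-true {notIn i j k} q)) p ≡.refl)
      (λ {k} {l} k≢l q p → counted-antipode {k} {l} {not (same (lookup σ k) (lookup σ l))} k≢l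
        (proj₁ (∧-true q)) (proj₂ (∧-true {notIn i j k} q)) p ≡.refl)

-- Large zones force large faces around every vertex

module Crowding {c ℓ₁ ℓ₂} (R : OrderedCommutativeRing c ℓ₁ ℓ₂)
  {n} (5≤n : 5 ≤ n) (L : Fin n → Sphere.Vec3 R) (general : Sphere.GeneralPosition R L) where
  open import Data.Nat using (_+_)
  open OrderedRing R using (_<_; _<?_; 0#; <-respʳ-≈; sym; compare; negative⇒-positive; positive?-true)
  open Sphere R
  open Vectors R
  open GreatCircles R L general
  open Zones R L general
  open OrientedArrangement arrangement using (Corner; corner?; corners; size)
  open Faces arrangement 5≤n
  open Discharging arrangement 5≤n using (around; not-crowded; Crowded)

  avoiding-comm : ∀ i j τ k l → avoiding i j τ k l ≡ avoiding j i τ k l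
  avoiding-comm i j τ k l = cong (λ b → if b then corners τ k l else 0) (cong₂ _∧_
    (𝔹.∧-comm (not (does (k ≟ i))) (not (does (k ≟ j)))) (𝔹.∧-comm (not (does (l ≟ i))) (not (does (l ≟ j)))))

  -- 3 counts the corner of i and j and its two neighbours on the boundary.
  size-≥-avoiding : ∀ τ {i j} → Corner τ i j → 3 + ∑∑ (avoiding i j τ) ≤ size τ
  size-≥-avoiding τ {i} {j} ij = begin
    3 + ∑∑ (avoiding i j τ)                         ≤⟨ ℕₚ.+-monoˡ-≤ _ three ⟩
    ∑∑ touching + ∑∑ (avoiding i j τ)               ≡⟨ ∑∑-distrib-+ touching (avoiding i j τ) ⟨
    ∑∑ (λ k l → touching k l + avoiding i j τ k l)  ≡⟨ ∑∑-cong (λ k l → split (notIn i j k ∧ notIn i j l)) ⟩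
    size τ                                          ∎
    where
    open ℕₚ.≤-Reasoning
    touching : Fin n → Fin n → ℕ
    touching k l = if notIn i j k ∧ notIn i j l then 0 else corners τ k l
    split : ∀ b {x} → (if b then 0 else x) + (if b then x else 0) ≡ x
    split true = ≡.refl
    split false = ℕₚ.+-identityʳ _
    h k : Fin n
    h = proj₁ (previous ij)
    k = proj₁ (next ij)
    hi : Corner τ h i
    hi = proj₂ (previous ij)
    jk : Corner τ j k
    jk = proj₂ (next ij)
    i-in : notIn i j i ≡ false
    i-in rewrite dec-true (i ≟ i) ≡.refl = ≡.refl
    j-in : notIn i j j ≡ false
    j-in rewrite dec-true (j ≟ j) ≡.refl = 𝔹.∧-zeroʳ _
    first : ∀ {a b} → notIn i j a ≡ false → Corner τ a b → 1 ≤ touching a b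
    first a∈ ab rewrite a∈ = ℕₚ.≤-reflexive (≡.sym (corners-Corner ab))
    second : ∀ {a b} → notIn i j b ≡ false → Corner τ a b → 1 ≤ touching a b
    second {a} b∈ ab rewrite b∈ | 𝔹.∧-zeroʳ (notIn i j a) = ℕₚ.≤-reflexive (≡.sym (corners-Corner ab))
    three : 3 ≤ ∑∑ touching
    three = ℕₚ.≤-trans
      (ℕₚ.+-mono-≤ (second {h} i-in hi) (ℕₚ.+-mono-≤ (first i-in ij) (ℕₚ.+-mono-≤ (first j-in jk) z≤n)))
      (∑∑-≥-unique touching {(h , i) ∷ (i , j) ∷ (j , k) ∷ []}
        ((proj₁ hi ∷ (λ h≡j → no-digon ij (subst (λ x → Corner τ x i) h≡j hi)) ∷ []) ∷ (proj₁ ij ∷ []) ∷ [] ∷ []))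

  -- Each of the four faces has three corners on the deleted circles, hence 12 = 4 · 3.
  sizes-≥-zone : ∀ {σ i j} → Corner σ i j →
    12 + zoneComplexity L i j (same (lookup σ i) (lookup σ j)) ≤ around (λ τ _ _ → size τ) σ i j
  sizes-≥-zone {σ} {i} {j} ij = begin
    12 + zoneComplexity L i j (same (lookup σ i) (lookup σ j))
      ≤⟨ ℕₚ.+-monoʳ-≤ 12 (zone-≤ {σ} ij) ⟩
    12 + ∑∑ (meeting σ i j)
      ≡⟨ cong (12 +_) distribute ⟩
    12 + (A σ + A (flip i σ) + A (flip j σ) + A (flip i (flip j σ)))
      ≡⟨ solve 4 (λ a b c d → con 12 :+ (a :+ b :+ c :+ d) := (con 3 :+ a) :+ (con 3 :+ b) :+ (con 3 :+ c) :+ (con 3 :+ d))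
          ≡.refl (A σ) (A (flip i σ)) (A (flip j σ)) (A (flip i (flip j σ))) ⟩
    (3 + A σ) + (3 + A (flip i σ)) + (3 + A (flip j σ)) + (3 + A (flip i (flip j σ)))
      ≤⟨ ℕₚ.+-mono-≤ (ℕₚ.+-mono-≤ (ℕₚ.+-mono-≤ (size-≥-avoiding σ ij)
          (reversed (flip i σ) (flip-in ij))) (reversed (flip j σ) (flip-out ij)))
          (size-≥-avoiding (flip i (flip j σ)) (flip-both ij)) ⟩
    around (λ τ _ _ → size τ) σ i j ∎
    where
    open ℕₚ.≤-Reasoning
    open +-*-Solver
    A : Vec Bool n → ℕ
    A τ = ∑∑ (avoiding i j τ)
    reversed : ∀ τ → Corner τ j i → 3 + A τ ≤ size τ
    reversed τ ji = subst (λ x → 3 + x ≤ size τ) (∑∑-cong (avoiding-comm j i τ)) (size-≥-avoiding τ ji)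
    distribute : ∑∑ (meeting σ i j) ≡ A σ + A (flip i σ) + A (flip j σ) + A (flip i (flip j σ))
    distribute = ≡.trans
      (∑∑-distrib-+ (λ k l → avoiding i j σ k l + avoiding i j (flip i σ) k l + avoiding i j (flip j σ) k l) (avoiding i j (flip i (flip j σ))))
      (cong (_+ A (flip i (flip j σ))) (≡.trans
        (∑∑-distrib-+ (λ k l → avoiding i j σ k l + avoiding i j (flip i σ) k l) (avoiding i j (flip j σ)))
        (cong (_+ A (flip j σ)) (∑∑-distrib-+ (avoiding i j σ) (avoiding i j (flip i σ))))))

  -- Each further circle is oriented so that the point L i × L j lies on its positive side. The
  -- guard `notIn` leaves `i` and `j` as given, so this point is indeed the vertex of the corner.
  some-corner : ∀ {i j} → i ≢ j → ∃ λ σ → Corner σ i j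
  some-corner {i} {j} i≢j = σ , corner-intro {σ} {i} {j} (i≢j , λ m m≢i m≢j →
    positive?-true (<-respʳ-≈ (det-cycle (normal σ m) (normal σ i) (normal σ j)) (inside m m≢i m≢j)))
    where
    behind : Fin n → Bool
    behind m = notIn i j m ∧ does (det (L m) (L i) (L j) <? 0#)
    σ : Vec Bool n
    σ = Vec.tabulate behind
    normal-behind : ∀ m {b} → behind m ≡ b → normal σ m ≡ signed b (L m)
    normal-behind m eq = cong (λ b → signed b (L m)) (≡.trans (Vecₚ.lookup∘tabulate behind m) eq)
    at-i : normal σ i ≡ L i
    at-i = normal-behind i (cong (λ b → (not b ∧ not (does (i ≟ j))) ∧ does (det (L i) (L i) (L j) <? 0#))
      (dec-true (i ≟ i) ≡.refl))
    at-j : normal σ j ≡ L j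
    at-j = normal-behind j (cong (_∧ does (det (L j) (L i) (L j) <? 0#))
      (≡.trans (cong (λ b → not (does (j ≟ i)) ∧ not b) (dec-true (j ≟ j) ≡.refl)) (𝔹.∧-zeroʳ _)))
    oriented : ∀ m → m ≢ i → m ≢ j → 0# < dot (normal σ m) (cross (L i) (L j))
    oriented m m≢i m≢j = decide (det (L m) (L i) (L j) <? 0#)
      where
      decide : Dec (det (L m) (L i) (L j) < 0#) → 0# < dot (normal σ m) (cross (L i) (L j))
      decide (yes <0) = subst (λ a → 0# < dot a (cross (L i) (L j)))
        (≡.sym (normal-behind m (cong₂ _∧_ (notIn-intro {i} {j} {m} m≢i m≢j) (dec-true (_ <? 0#) <0))))
        (<-respʳ-≈ (sym (dot-negˡ (L m) (cross (L i) (L j)))) (negative⇒-positive <0))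
      decide (no ≮0) with compare (det (L m) (L i) (L j)) 0#
      ... | tri< <0 _ _ = ⊥-elim (≮0 <0)
      ... | tri≈ _ ≈0 _ = ⊥-elim (proj₂ general m i j m≢i i≢j m≢j ≈0)
      ... | tri> _ _ 0< = subst (λ a → 0# < dot a (cross (L i) (L j)))
        (≡.sym (normal-behind m (cong₂ _∧_ (notIn-intro {i} {j} {m} m≢i m≢j) (dec-false (_ <? 0#) ≮0)))) 0<
    inside : ∀ m → m ≢ i → m ≢ j → 0# < det (normal σ m) (normal σ i) (normal σ j)
    inside m m≢i m≢j = ≡.subst₂ (λ a b → 0# < dot (normal σ m) (cross a b)) (≡.sym at-i) (≡.sym at-j) (oriented m m≢i m≢j)

  crowded : (∀ i j s → i ≢ j → 6 ≤ zoneComplexity L i j s) → Crowded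
  crowded large {σ} {i} {j} ij = ℕₚ.≤-trans
    (ℕₚ.+-monoʳ-≤ 12 (large i j (same (lookup σ i) (lookup σ j)) (proj₁ ij))) (sizes-≥-zone {σ} ij)

  not-all-large : ∀ {i j : Fin n} → i ≢ j → ¬ (∀ i j s → i ≢ j → 6 ≤ zoneComplexity L i j s)
  not-all-large i≢j large = not-crowded (proj₂ (some-corner i≢j)) (crowded large)

-- Finding the vertex

bool-any? : ∀ {p} {P : Bool → Set p} → (∀ b → Dec (P b)) → Dec (∃ P)
bool-any? P? = map′ (λ { (inj₁ p) → true , p ; (inj₂ p) → false , p })
  (λ { (true , p) → inj₁ p ; (false , p) → inj₂ p }) (P? true ⊎-dec P? false)

length-filterᵇ : ∀ {a} {A : Set a} (P : A → Bool) xs → length (filterᵇ P xs) ≤ length xs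
length-filterᵇ P [] = z≤n
length-filterᵇ P (x ∷ xs) with P x
... | true = s≤s (length-filterᵇ P xs)
... | false = ℕₚ.m≤n⇒m≤1+n (length-filterᵇ P xs)

-- C(v) ≤ 5 is decidable and the vertices are finitely many, so refuting that all zones are large
-- yields a vertex without classical logic.
small-vertex : ∀ {c ℓ₁ ℓ₂} (R : OrderedCommutativeRing c ℓ₁ ℓ₂) (n : ℕ) → 5 ≤ n →
  (L : Fin n → Sphere.Vec3 R) → Sphere.GeneralPosition R L → {i j : Fin n} → i ≢ j →
  ∃ λ (i : Fin n) → ∃ λ (j : Fin n) → ∃ λ (s : Bool) →
  (i ≢ j) × (Sphere.zoneComplexity R L i j s ≤ 5)
small-vertex R n 5≤n L general i≢j = decide (any? λ i → any? λ j → bool-any? (small? i j))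
  where
  Small : Fin n → Fin n → Bool → Set
  Small i j s = (i ≢ j) × (Sphere.zoneComplexity R L i j s ≤ 5)
  small? : ∀ i j s → Dec (Small i j s)
  small? i j s = ¬? (i ≟ j) ×-dec (Sphere.zoneComplexity R L i j s ℕ.≤? 5)
  decide : Dec (∃ λ i → ∃ λ j → ∃ λ s → Small i j s) → ∃ λ i → ∃ λ j → ∃ λ s → Small i j s
  decide (yes found) = found
  decide (no none) = ⊥-elim (Crowding.not-all-large R 5≤n L general i≢j
    (λ i j s i≢j → ℕₚ.≰⇒> (λ small → none (i , j , s , i≢j , small))))

zone-≤-vertices : ∀ {c ℓ₁ ℓ₂} (R : OrderedCommutativeRing c ℓ₁ ℓ₂) {n} (L : Fin n → Sphere.Vec3 R) i j s →
  Sphere.zoneComplexity R L i j s ≤ length (Sphere.subVertices R i j)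
zone-≤-vertices R L i j s = length-filterᵇ _ (Sphere.subVertices R i j)

theorem2 : ∀ {c ℓ₁ ℓ₂} (R : OrderedCommutativeRing c ℓ₁ ℓ₂) (n : ℕ) → 2 ≤ n →
    (L : Fin n → Sphere.Vec3 R) → Sphere.GeneralPosition R L →
    ∃ λ (i : Fin n) → ∃ λ (j : Fin n) → ∃ λ (s : Bool) →
    (i ≢ j) × (Sphere.zoneComplexity R L i j s ≤ 5)
theorem2 R 0 ()
theorem2 R 1 (s≤s ())
-- For n ≤ 4 the deletion leaves at most two circles, hence at most two vertices in all.
theorem2 R 2 _ L _ = Fin.zero , Fin.suc Fin.zero , true , (λ ()) ,
  ℕₚ.≤-trans (zone-≤-vertices R L Fin.zero (Fin.suc Fin.zero) true) z≤n
theorem2 R 3 _ L _ = Fin.zero , Fin.suc Fin.zero , true , (λ ()) ,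
  ℕₚ.≤-trans (zone-≤-vertices R L Fin.zero (Fin.suc Fin.zero) true) z≤n
theorem2 R 4 _ L _ = Fin.zero , Fin.suc Fin.zero , true , (λ ()) ,
  ℕₚ.≤-trans (zone-≤-vertices R L Fin.zero (Fin.suc Fin.zero) true) (ℕₚ.m≤m+n 2 3)
theorem2 R n@(suc (suc (suc (suc (suc _))))) _ L general =
  small-vertex R n (s≤s (s≤s (s≤s (s≤s (s≤s z≤n))))) L general {Fin.zero} {Fin.suc Fin.zero} (λ ())
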